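{- Let $n\ge 2$. For $\omega\in\mathfrak{B}_n$ selected uniformly at random, with $\alpha=\alpha(\omega)$ and $\beta=\beta(\omega)$, the expectations and variances are $$\mathbb{E}[\alpha]=\mathbb{E}[\beta]=\frac{(n+3)(n+2)(n+1)}{60}=\frac{\mathfrak{b}_{n+2}}{10}$$ and $$\mathrm{Var}[\alpha]=\mathrm{Var}[\beta]=\frac{(n+3)(n+2)^2(n+1)^2(n-2)}{2400}=\frac{3(n-2)\,\mathbb{E}[\alpha]^2}{2(n+3)}.$$
   Context: $\mathfrak{S}_n$ is the set of permutations of $[n]=\{1,\dots,n\}$, in one-line notation. A reduction of $\omega\in\mathfrak{S}_n$ interchanges $\omega(i)$ and $\omega(j)$ for some $i<j$ with $\omega(i)>\omega(j)$. Bruhat order: $\pi\le\sigma$ if $\pi$ is obtained from $\sigma$ by a (possibly empty) sequence of reductions. $\mathfrak{B}_n\subseteq\mathfrak{S}_n$ is the set of bigrassmannian permutations, i.e. those $\omega$ such that both $\omega$ and $\omega^{ -1}$ have exactly one descent; equivalently $\omega=1\cdots a\,(b+1)\cdots c\,(a+1)\cdots b\,(c+1)\cdots n$ for some $0\le a<b<c\le n$. $\mathfrak{b}_n=|\mathfrak{B}_n|=\binom{n+1}{3}$. For $\omega\in\mathfrak{B}_n$, $\beta(\omega)$ is the number of $\pi\in\mathfrak{B}_n$ with $\pi\le\omega$, and $\alpha(\omega)$ is the number of $\tau\in\mathfrak{B}_n$ with $\omega\le\tau$. -}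

module Defs where

open import Data.Empty using (⊥-elim)
open import Data.Fin.Base using (Fin; zero; suc; toℕ; punchIn; combine; funToFin; _<_)
import Data.Fin.Properties as Fin
import Data.Fin.Induction as Fin
open import Data.Fin.Permutation
  using (Permutation′; _≈_; _⟨$⟩ʳ_; flip; _∘ₚ_; transpose; insert;
         remove; insert-remove)
import Data.Fin.Permutation as Perm
open import Data.Integer.Base using (+_)
open import Data.List.Base
  using (List; []; _∷_; length; map; filter; foldr; allFin; cartesianProductWith)
open import Data.List.Membership.Propositional.Properties using (∈-allFin)
import Data.List.Membership.Setoid as SetoidMembership
import Data.List.Membership.Setoid.Properties as Membership
open import Data.List.Relation.Unary.Any using (here)
open import Data.List.Relation.Unary.AllPairs using ([]; _∷_)
open import Data.List.Relation.Unary.All using ([])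
import Data.List.Relation.Unary.Unique.Setoid as SetoidUnique
import Data.List.Relation.Unary.Unique.Setoid.Properties as Unique
import Data.List.Relation.Unary.Unique.Propositional.Properties as UniqueP
open import Data.Nat.Base as ℕ using (ℕ; zero; suc; z<s)
import Data.Nat.Properties as ℕ
open import Data.Product using (Σ; ∃; ∃₂; ∃!; _×_; _,_; proj₁; proj₂)
open import Data.Rational.Base as ℚ using (ℚ; 0ℚ; _/_)
open import Function.Base using (_∘_)
open import Induction.WellFounded using (Acc; acc)
open import Level using (0ℓ)
open import Relation.Binary.Bundles using (Setoid)
open import Relation.Binary.Construct.Closure.ReflexiveTransitive using (Star; ε; _◅_)
open import Relation.Binary.PropositionalEquality
  using (_≡_; _≢_; refl; sym; trans; cong; subst; subst₂; setoid)
open import Relation.Nullary.Decidable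
  using (Dec; yes; no; map′; _×-dec_; _→-dec_; dec-true; dec-false)
open import Relation.Unary using (Decidable)

private variable
  n : ℕ

------------------------------------------------------------------------
-- The symmetric group, up to pointwise equality _≈_; positions and
-- values are 0, …, n-1 instead of 1, …, n.

permSetoid : ℕ → Setoid 0ℓ 0ℓ
permSetoid n = record
  { Carrier       = Permutation′ n
  ; _≈_           = _≈_
  ; isEquivalence = record
    { refl  = λ _ → refl
    ; sym   = λ p i → sym (p i)
    ; trans = λ p q i → trans (p i) (q i)
    }
  }

-- Every permutation of Fin (suc n) is insert zero j π for unique j and π
-- (namely, j is the value at position 0).
𝔖 : ∀ n → List (Permutation′ n)
𝔖 zero    = Perm.id ∷ []
𝔖 (suc n) = cartesianProductWith (insert zero) (allFin (suc n)) (𝔖 n)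

private
  insert-cong : ∀ {j k : Fin (suc n)} {π ρ : Permutation′ n} →
                j ≡ k → π ≈ ρ → insert zero j π ≈ insert zero k ρ
  insert-cong         refl p zero    = refl
  insert-cong {j = j} refl p (suc i) = cong (punchIn j) (p i)

  insert-injective : ∀ {j k : Fin (suc n)} {π ρ : Permutation′ n} →
                     insert zero j π ≈ insert zero k ρ → j ≡ k × π ≈ ρ
  insert-injective {j = j} {π = π} {ρ} p with p zero
  ... | refl = refl , λ i → Fin.punchIn-injective j _ _ (p (suc i))

𝔖-complete : ∀ n (π : Permutation′ n) →
             let open SetoidMembership (permSetoid n) in π ∈ 𝔖 n
𝔖-complete zero    π = here (λ ())
𝔖-complete (suc n) π =
  Membership.∈-resp-≈ (permSetoid (suc n)) {𝔖 (suc n)}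
    {insert zero (π ⟨$⟩ʳ zero) (remove zero π)} {π} (insert-remove zero π)
    (Membership.∈-cartesianProductWith⁺
      (setoid _) (permSetoid n) (permSetoid (suc n))
      (λ {j} {k} {π} {ρ} → insert-cong {n} {j} {k} {π} {ρ})
      (∈-allFin (π ⟨$⟩ʳ zero)) (𝔖-complete n (remove zero π)))

𝔖-unique : ∀ n → let open SetoidUnique (permSetoid n) in Unique (𝔖 n)
𝔖-unique zero    = [] ∷ []
𝔖-unique (suc n) = Unique.cartesianProductWith⁺
  (setoid _) (permSetoid n) (permSetoid (suc n)) (insert zero)
  (λ {j} {k} {π} {ρ} → insert-injective {n} {j} {k} {π} {ρ})
  (UniqueP.allFin⁺ (suc n)) (𝔖-unique n)

------------------------------------------------------------------------
-- Bigrassmannian permutations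

IsDescent : Permutation′ n → Fin n → Set
IsDescent {n} ω i =
  ∃ λ (j : Fin n) → toℕ j ≡ suc (toℕ i) × (ω ⟨$⟩ʳ j) < (ω ⟨$⟩ʳ i)

HasOneDescent : Permutation′ n → Set
HasOneDescent ω = ∃! _≡_ (IsDescent ω)

IsBigrassmannian : Permutation′ n → Set
IsBigrassmannian ω = HasOneDescent ω × HasOneDescent (flip ω)

isDescent? : (ω : Permutation′ n) → Decidable (IsDescent ω)
isDescent? ω i = Fin.any? λ j →
  (toℕ j ℕ.≟ suc (toℕ i)) ×-dec ((ω ⟨$⟩ʳ j) Fin.<? (ω ⟨$⟩ʳ i))

hasOneDescent? : Decidable (HasOneDescent {n})
hasOneDescent? ω = Fin.any? λ i → isDescent? ω i ×-dec
  map′ (λ f {j} → f j) (λ f j → f {j})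
    (Fin.all? λ j → isDescent? ω j →-dec (i Fin.≟ j))

isBigrassmannian? : Decidable (IsBigrassmannian {n})
isBigrassmannian? ω = hasOneDescent? ω ×-dec hasOneDescent? (flip ω)

𝔅 : ∀ n → List (Permutation′ n)
𝔅 n = filter isBigrassmannian? (𝔖 n)

𝔟 : ℕ → ℕ
𝔟 n = length (𝔅 n)

------------------------------------------------------------------------
-- Bruhat order

-- _∘ₚ_ is composition in diagrammatic order, so transpose i j ∘ₚ σ
-- interchanges the entries of σ at positions i and j.
data _⟶_ (σ : Permutation′ n) : Permutation′ n → Set where
  interchange : ∀ {i j} → i < j → (σ ⟨$⟩ʳ j) < (σ ⟨$⟩ʳ i) →
                σ ⟶ (transpose i j ∘ₚ σ)

infix 4 _⟶_ _≤ᴮ_ _≤ᴮ?_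

_≤ᴮ_ : Permutation′ n → Permutation′ n → Set
π ≤ᴮ σ = ∃ λ τ → Star _⟶_ σ τ × τ ≈ π

-- A reduction makes the one-line word lexicographically smaller, so the
-- search for a sequence of reductions terminates.
private
  word : Permutation′ n → Fin (n ℕ.^ n)
  word σ = funToFin (σ ⟨$⟩ʳ_)

  combine-monoʳ-< : ∀ {m n} (i : Fin m) {k l : Fin n} →
                    k < l → combine i k < combine i l
  combine-monoʳ-< i {k} {l} k<l =
    subst₂ ℕ._<_ (sym (Fin.toℕ-combine i k)) (sym (Fin.toℕ-combine i l))
      (ℕ.+-monoʳ-< _ k<l)

  funToFin-lex : ∀ {m n} {f g : Fin m → Fin n} (i : Fin m) →
                 g i < f i → (∀ k → k < i → g k ≡ f k) →
                 funToFin g < funToFin f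
  funToFin-lex {f = f} {g} zero    gi<fi eq =
    Fin.combine-monoˡ-< (funToFin (g ∘ suc)) (funToFin (f ∘ suc)) gi<fi
  funToFin-lex {f = f} {g} (suc i) gi<fi eq rewrite eq zero z<s =
    combine-monoʳ-< (f zero)
      (funToFin-lex i gi<fi (λ k k<i → eq (suc k) (ℕ.s<s k<i)))

  transpose-left : (i j : Fin n) → transpose i j ⟨$⟩ʳ i ≡ j
  transpose-left i j rewrite dec-true (i Fin.≟ i) refl = refl

  transpose-fix : ∀ {i j k : Fin n} → k ≢ i → k ≢ j → transpose i j ⟨$⟩ʳ k ≡ k
  transpose-fix {i = i} {j} {k} k≢i k≢j
    rewrite dec-false (k Fin.≟ i) k≢i | dec-false (k Fin.≟ j) k≢j = refl

  word-decreases : ∀ {σ τ : Permutation′ n} → σ ⟶ τ → word τ < word σ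
  word-decreases {σ = σ} (interchange {i} {j} i<j σj<σi) = funToFin-lex i
    (subst (λ k → (σ ⟨$⟩ʳ k) < (σ ⟨$⟩ʳ i)) (sym (transpose-left i j)) σj<σi)
    (λ k k<i → cong (σ ⟨$⟩ʳ_)
      (transpose-fix (Fin.<⇒≢ k<i) (Fin.<⇒≢ (Fin.<-trans k<i i<j))))

  search : (π σ : Permutation′ n) → Acc _<_ (word σ) → Dec (π ≤ᴮ σ)
  search {n} π σ (acc rec)
    with Fin.all? (λ i → (σ ⟨$⟩ʳ i) Fin.≟ (π ⟨$⟩ʳ i))
  ... | yes σ≈π = yes (σ , ε , σ≈π)
  ... | no  σ≉π = map′ to from (Fin.any? λ i → Fin.any? λ j → step? i j)
    where
    Step : Fin n → Fin n → Set
    Step i j = Σ (i < j × (σ ⟨$⟩ʳ j) < (σ ⟨$⟩ʳ i)) λ _ → π ≤ᴮ (transpose i j ∘ₚ σ)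

    step? : ∀ i j → Dec (Step i j)
    step? i j with (i Fin.<? j) ×-dec ((σ ⟨$⟩ʳ j) Fin.<? (σ ⟨$⟩ʳ i))
    ... | no  ¬p = no (¬p ∘ proj₁)
    ... | yes p@(i<j , σj<σi) = map′ (p ,_) proj₂
      (search π (transpose i j ∘ₚ σ)
        (rec (word-decreases {σ = σ} (interchange i<j σj<σi))))

    to : ∃₂ Step → π ≤ᴮ σ
    to (i , j , (i<j , σj<σi) , τ , r , τ≈π) =
      τ , interchange i<j σj<σi ◅ r , τ≈π

    from : π ≤ᴮ σ → ∃₂ Step
    from (_ , ε , σ≈π) = ⊥-elim (σ≉π σ≈π)
    from (τ , interchange i<j σj<σi ◅ r , τ≈π) =
      _ , _ , (i<j , σj<σi) , τ , r , τ≈π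

_≤ᴮ?_ : (π σ : Permutation′ n) → Dec (π ≤ᴮ σ)
π ≤ᴮ? σ = search π σ (Fin.<-wellFounded (word σ))

β : Permutation′ n → ℕ
β {n} ω = length (filter (λ π → π ≤ᴮ? ω) (𝔅 n))

α : Permutation′ n → ℕ
α {n} ω = length (filter (λ τ → ω ≤ᴮ? τ) (𝔅 n))

------------------------------------------------------------------------
-- Uniform expectation and variance over the entries of a list; the value
-- for the empty list is a dummy.

fromℕ : ℕ → ℚ
fromℕ k = + k / 1

𝔼 : {A : Set} → List A → (A → ℚ) → ℚ
𝔼 []           X = 0ℚ
𝔼 xs@(_ ∷ _) X = foldr ℚ._+_ 0ℚ (map X xs) ℚ.* (+ 1 / length xs)

Var : {A : Set} → List A → (A → ℚ) → ℚ
Var xs X = 𝔼 xs λ x → (X x ℚ.- 𝔼 xs X) ℚ.* (X x ℚ.- 𝔼 xs X)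

𝔼α 𝔼β Varα Varβ : ℕ → ℚ
𝔼α n   = 𝔼 (𝔅 n) (fromℕ ∘ α)
𝔼β n   = 𝔼 (𝔅 n) (fromℕ ∘ β)
Varα n = Var (𝔅 n) (fromℕ ∘ α)
Varβ n = Var (𝔅 n) (fromℕ ∘ β)

{-# OPTIONS --safe #-}

-- A bigrassmannian permutation interchanges two adjacent blocks of a word; record it by the number a
-- of fixed points before the blocks, the number d after them, and the block lengths v + 1 and u + 1,
-- so that a + d + u + v = n - 2.  Bruhat order between two of them is: a and d decrease, u and v
-- increase.  For "only if", each of the four inequalities is read off a region of the plane (a
-- staircase) that the graph of a permutation cannot leave under reductions.  For "if", a permutation
-- with at least C of its first a + C values ≥ a + B can be reduced, keeping this property, as long
-- as it is not the block swap with these parameters.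
-- Hence β = Σ (i + j + 1) over i ≤ u, j ≤ v, that is (u + 1)(v + 1)(u + v + 2) / 2, and exchanging
-- (a , d) with (u , v) reverses the order, which gives α.  The first two moments are then sums of
-- polynomials over the codes.
module Submission where

open import Defs
open import Data.Nat.Base as ℕ hiding (_/_)
open import Data.Nat.Properties
import Data.Nat.Properties as ℕ
open import Data.Nat.ListAction using (sum)
open import Data.Nat.ListAction.Properties using (sum-++; sum-↭)
open import Data.Nat.Tactic.RingSolver using (solve-∀)
import Data.Integer.Base as ℤ
import Data.Integer.Properties as ℤ
open import Data.Rational.Base as ℚ using (ℚ; 0ℚ; 1ℚ; _/_; toℚᵘ)
import Data.Rational.Properties as ℚ
open import Data.Rational.Unnormalised.Base as ℚᵘ using (mkℚᵘ; *≡*)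
import Data.Rational.Unnormalised.Properties as ℚᵘ
open import Data.Rational.Solver using (module +-*-Solver)
open +-*-Solver using (solve; _:+_; _:*_; _:-_; _:=_; con)
open import Algebra.Properties.Group ℚ.+-0-group using (∙-cancelʳ)
open import Data.Bool.Base using (if_then_else_)
open import Data.Empty using (⊥-elim)
open import Data.Fin.Base as Fin using (Fin; toℕ; fromℕ<; funToFin)
import Data.Fin.Properties as Fin
import Data.Fin.Induction as Fin
open import Data.Fin.Permutation
  using (Permutation′; permutation; _≈_; _⟨$⟩ʳ_; _⟨$⟩ˡ_; flip; _∘ₚ_; transpose; inverseˡ; inverseʳ)
open import Data.List.Base using (List; []; _∷_; _++_; map; length; filter; foldr)
open import Data.List.Properties using (map-++; map-∘; map-cong; length-map)
open import Data.List.Membership.Propositional using (_∈_; find)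
open import Data.List.Membership.Propositional.Properties
  using (∈-map⁺; ∈-map⁻; ∈-++⁺ˡ; ∈-++⁺ʳ; ∈-++⁻; ∈-filter⁺; ∈-filter⁻; ∈-∃++)
open import Data.List.Relation.Unary.All as All using ([]; _∷_)
import Data.List.Relation.Unary.All.Properties as All
open import Data.List.Relation.Unary.AllPairs using (AllPairs; []; _∷_)
import Data.List.Relation.Unary.AllPairs.Properties as AllPairs
open import Data.List.Relation.Unary.Any using (here; there)
open import Data.List.Relation.Unary.Unique.Propositional using (Unique)
import Data.List.Relation.Unary.Unique.Propositional.Properties as Unique
open import Data.List.Relation.Binary.Permutation.Propositional using (_↭_; ↭⇒↭ₛ; ↭-sym)
open import Data.List.Relation.Binary.Permutation.Propositional.Properties 
  using (∈-resp-↭; map⁺) renaming (shift to ↭-shift)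
import Data.List.Relation.Binary.Permutation.Setoid.Properties as SetoidPermutation
open import Data.Product.Base using (∃; ∃₂; _×_; _,_; proj₁; proj₂; map₁; map₂; swap)
open import Data.Product.Properties using (,-injectiveʳ)
open import Data.Sum.Base using (_⊎_; inj₁; inj₂)
open import Function.Base using (_∘_; const; id)
open import Induction.WellFounded using (Acc; acc)
open import Relation.Binary.Construct.Closure.ReflexiveTransitive using (Star; ε; _◅_)
open import Relation.Binary.Definitions using (tri<; tri≈; tri>)
open import Relation.Binary.PropositionalEquality
open import Relation.Nullary using (¬_; yes; no; does)
open import Relation.Nullary.Decidable using (dec-true; dec-false; decidable-stable; ¬?; _×-dec_)
open import Relation.Unary using (Decidable)

private variable
  n N : ℕ
  A A′ : Set

-- Block swaps of ℕ

-- The "if" direction needs one entry of the rank function instead of all of them, because a block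
-- swap is the least permutation satisfying its own rank inequality. A permutation and its inverse
-- that both ascend away from one break each must be a block swap; the two breaks leave only the
-- length of the fixed prefix open. This is why the reduction process can stop at a wrong block
-- swap, and why comparing prefixes settles that case. The same classification, which admits empty
-- blocks and hence the identity, produces the codes of bigrassmannian permutations. Permutations
-- are extended by the identity to all of ℕ, so that positions and values carry no bounds in these
-- arguments. As `𝔖` lists permutations up to pointwise equality, counting goes through a relation
-- between permutations and codes instead of a map. Moments are kept as identities of natural
-- numbers with cleared denominators, which is where constants such as 360 and 8640 come from;
-- rationals enter only at the end.

blockSwap : ℕ → ℕ → ℕ → ℕ → ℕ
blockSwap (suc a) B C zero    = zero
blockSwap (suc a) B C (suc k) = suc (blockSwap a B C k)
blockSwap zero    B C k       =
  if does (k <? C) then B + k else if does (k <? C + B) then k ∸ C else k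

blockSwap-before : ∀ a B C {k} → k < a → blockSwap a B C k ≡ k
blockSwap-before (suc a) B C {zero}  _         = refl
blockSwap-before (suc a) B C {suc k} (s≤s k<a) = cong suc (blockSwap-before a B C k<a)

blockSwap-left : ∀ a B C {t} → t < C → blockSwap a B C (a + t) ≡ a + (B + t)
blockSwap-left zero    B C {t} t<C rewrite dec-true (t <? C) t<C = refl
blockSwap-left (suc a) B C t<C = cong suc (blockSwap-left a B C t<C)

blockSwap-right : ∀ a B C {t} → t < B → blockSwap a B C (a + (C + t)) ≡ a + t
blockSwap-right zero B C {t} t<B
  rewrite dec-false (C + t <? C) (m+n≮m C t)
        | dec-true (C + t <? C + B) (+-monoʳ-< C t<B) = m+n∸m≡n C t
blockSwap-right (suc a) B C t<B = cong suc (blockSwap-right a B C t<B)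

blockSwap-after : ∀ a B C t → blockSwap a B C (a + (C + (B + t))) ≡ a + (B + (C + t))
blockSwap-after zero B C t
  rewrite dec-false (C + (B + t) <? C) (m+n≮m C (B + t))
        | dec-false (C + (B + t) <? C + B) (λ p → m+n≮m B t (+-cancelˡ-< C _ _ p))
        | sym (+-assoc C B t) | +-comm C B = +-assoc B C t
blockSwap-after (suc a) B C t = cong suc (blockSwap-after a B C t)

-- Each case carries the offset into its block, so the four value lemmas apply by rewriting and no
-- truncated subtraction appears. Blocks may be empty.
data Block (a B C : ℕ) : ℕ → Set where
  before : ∀ {k} → k < a → Block a B C k
  left   : ∀ {t} → t < C → Block a B C (a + t)
  right  : ∀ {t} → t < B → Block a B C (a + (C + t))
  after  : ∀ t → Block a B C (a + (C + (B + t)))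

block : ∀ a B C k → Block a B C k
block a B C k with k <? a
... | yes k<a = before k<a
... | no  k≮a with m≤n⇒∃[o]m+o≡n (≮⇒≥ k≮a)
... | t , refl with t <? C
... | yes t<C = left t<C
... | no  t≮C with m≤n⇒∃[o]m+o≡n (≮⇒≥ t≮C)
... | s , refl with s <? B
... | yes s<B = right s<B
... | no  s≮B with m≤n⇒∃[o]m+o≡n (≮⇒≥ s≮B)
... | r , refl = after r

blockSwap-inverse : ∀ a B C k → blockSwap a C B (blockSwap a B C k) ≡ k
blockSwap-inverse a B C k with block a B C k
... | before k<a rewrite blockSwap-before a B C k<a = blockSwap-before a C B k<a
... | left t<C   rewrite blockSwap-left a B C t<C   = blockSwap-right a C B t<C
... | right t<B  rewrite blockSwap-right a B C t<B  = blockSwap-left a C B t<B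
... | after t    rewrite blockSwap-after a B C t    = blockSwap-after a C B t

blockSwap-ascends : ∀ a B C k → suc k ≢ a + C → blockSwap a B C k < blockSwap a B C (suc k)
blockSwap-ascends (suc a) B C zero    _ = z<s
blockSwap-ascends (suc a) B C (suc k) k≢ = s<s (blockSwap-ascends a B C k (k≢ ∘ cong suc))
blockSwap-ascends zero B C k k≢ with block zero B C k
... | before ()
... | left {t} t<C rewrite blockSwap-left 0 B C t<C
                         | blockSwap-left 0 B C (≤∧≢⇒< t<C k≢) = +-monoʳ-< B ≤-refl
... | after t rewrite blockSwap-after 0 B C t | sym (+-suc C (B + t)) | sym (+-suc B t)
                    | blockSwap-after 0 B C (suc t) | +-suc C t = +-monoʳ-< B ≤-refl
... | right {t} t<B rewrite blockSwap-right 0 B C t<B | sym (+-suc C t)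
  with m≤n⇒m<n∨m≡n t<B
...   | inj₁ 1+t<B rewrite blockSwap-right 0 B C 1+t<B = ≤-refl
-- At the end of the right block the next position is the first one of the fixed tail, at offset 0.
...   | inj₂ refl = subst (λ k → t < blockSwap 0 B C k) (cong (C +_) (+-identityʳ B))
                      (subst (t <_) (sym (blockSwap-after 0 B C 0)) (m≤m+n B _))

blockSwap-descends : ∀ a B C → 0 < B → blockSwap a B (suc C) (suc (a + C)) < blockSwap a B (suc C) (a + C)
blockSwap-descends a B C 0<B = subst₂ _<_
  (sym (trans (cong (blockSwap a B (suc C)) eq) (blockSwap-right a B (suc C) 0<B)))
  (sym (blockSwap-left a B (suc C) ≤-refl))
  (+-monoʳ-< a (≤-trans 0<B (m≤m+n B C)))
  where
  eq : suc (a + C) ≡ a + (suc C + 0)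
  eq = trans (sym (+-suc a C)) (cong (λ x → a + suc x) (sym (+-identityʳ C)))

-- Bijections of ℕ with at most one descent in each direction

AscendsExceptAt : ℕ → (ℕ → ℕ) → Set
AscendsExceptAt i f = ∀ k → suc k ≢ i → f k < f (suc k)

ascend : ∀ {i f} → AscendsExceptAt i f → ∀ k t → i ≤ k ⊎ t + k < i → t + f k ≤ f (t + k)
ascend f↑ k zero    side = ≤-refl
ascend f↑ k (suc t) (inj₁ i≤k) = ≤-<-trans (ascend f↑ k t (inj₁ i≤k))
  (f↑ (t + k) (>⇒≢ (s≤s (≤-trans i≤k (m≤n+m k t)))))
ascend f↑ k (suc t) (inj₂ t+k<i) = ≤-<-trans (ascend f↑ k t (inj₂ (<-trans ≤-refl t+k<i)))
  (f↑ (t + k) (<⇒≢ t+k<i))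

-- A gap of t between f k and f (suc k) makes g climb by at least t between these two values. But
-- there g climbs from k to suc k, so t ≤ 1. The last hypothesis keeps the break of g out of the
-- gap.
consecutive : ∀ {i j f g} → (∀ k → g (f k) ≡ k) → AscendsExceptAt i f → AscendsExceptAt j g →
              ∀ k → suc k ≢ i → j ≤ f k ⊎ f (suc k) < j → f (suc k) ≡ suc (f k)
consecutive {i} {j} {f} {g} gf f↑ g↑ k k≢ side = ≤-antisym upper (f↑ k k≢)
  where
  open ≤-Reasoning
  t = f (suc k) ∸ f k
  t+fk : t + f k ≡ f (suc k)
  t+fk = m∸n+n≡m (<⇒≤ (f↑ k k≢))
  upper : f (suc k) ≤ suc (f k)
  upper = begin
    f (suc k) ≡⟨ t+fk ⟨
    t + f k   ≤⟨ +-monoˡ-≤ (f k) (+-cancelʳ-≤ k t 1 (begin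
      t + k         ≡⟨ cong (t +_) (gf k) ⟨
      t + g (f k)   ≤⟨ ascend g↑ (f k) t (subst (λ x → j ≤ f k ⊎ x < j) (sym t+fk) side) ⟩
      g (t + f k)   ≡⟨ cong g t+fk ⟩
      g (f (suc k)) ≡⟨ gf (suc k) ⟩
      suc k         ∎)) ⟩
    suc (f k) ∎

private
  -- This a becomes the length of the fixed prefix. If all values before i are small, a is i itself
  -- and the left block is empty.
  firstLarge : ∀ (f : ℕ → ℕ) j i → ∃ λ a → a ≤ i × (∀ k → k < a → f k < j) × (a < i → j ≤ f a)
  firstLarge f j zero = 0 , ≤-refl , (λ _ ()) , λ ()
  firstLarge f j (suc i) with firstLarge f j i
  ... | a , a≤i , small , large with m≤n⇒m<n∨m≡n a≤i
  ... | inj₁ a<i = a , m≤n⇒m≤1+n a≤i , small , λ _ → large a<i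
  ... | inj₂ refl with f i <? j
  ...   | yes fi<j = suc i , ≤-refl , small′ , λ p → ⊥-elim (<-irrefl refl p)
    where
    small′ : ∀ k → k < suc i → f k < j
    small′ k (s≤s k≤i) with m≤n⇒m<n∨m≡n k≤i
    ... | inj₁ k<i  = small k k<i
    ... | inj₂ refl = fi<j
  ...   | no fi≮j = i , n≤1+n i , small , λ _ → ≮⇒≥ fi≮j

module _ {f g : ℕ → ℕ} (fg : ∀ k → f (g k) ≡ k) (gf : ∀ k → g (f k) ≡ k) where
  private
    module Classify (a B C : ℕ) (f↑ : AscendsExceptAt (a + C) f) (g↑ : AscendsExceptAt (a + B) g)
      (small : ∀ k → k < a → f k < a + B) (large : 0 < C → a + B ≤ f a) where
      i = a + C
      j = a + B
      c = a + (C + B)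

      fixed : ∀ k → k < a → f k ≡ k
      -- On its way from 0 to f 0 the inverse g stays below its break, so it climbs by at least f 0;
      -- yet it ends at g (f 0) ≡ 0.
      fixed zero 0<a = n≤0⇒n≡0 (begin
        f 0         ≡⟨ +-identityʳ (f 0) ⟨
        f 0 + 0     ≤⟨ +-monoʳ-≤ (f 0) z≤n ⟩
        f 0 + g 0   ≤⟨ ascend g↑ 0 (f 0) (inj₂ (subst (_< j) (sym (+-identityʳ (f 0))) (small 0 0<a))) ⟩
        g (f 0 + 0) ≡⟨ cong g (+-identityʳ (f 0)) ⟩
        g (f 0)     ≡⟨ gf 0 ⟩
        0           ∎)
        where open ≤-Reasoning
      fixed (suc k) k<a = trans
        (consecutive gf f↑ g↑ k (<⇒≢ (<-≤-trans k<a (m≤m+n a C))) (inj₂ (small (suc k) k<a)))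
        (cong suc (fixed k (<-trans ≤-refl k<a)))

      g-fixed : ∀ k → k < a → g k ≡ k
      g-fixed k k<a = trans (cong g (sym (fixed k k<a))) (gf k)

      -- j is the least large value, so its position can be at most a.
      fa≡j : 0 < C → f a ≡ j
      fa≡j 0<C = trans (cong f (sym (≤-antisym gj≤a a≤gj))) (fg j)
        where
        open ≤-Reasoning
        j≤fa = large 0<C
        gj≤a : g j ≤ a
        gj≤a = begin
          g j               ≤⟨ m≤n+m (g j) (f a ∸ j) ⟩
          f a ∸ j + g j     ≤⟨ ascend g↑ j (f a ∸ j) (inj₁ ≤-refl) ⟩
          g (f a ∸ j + j)   ≡⟨ cong g (m∸n+n≡m j≤fa) ⟩
          g (f a)           ≡⟨ gf a ⟩
          a                 ∎
        a≤gj : a ≤ g j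
        a≤gj = ≮⇒≥ λ gj<a → <-irrefl (fg j) (small (g j) gj<a)

      f-left : ∀ t → t < C → f (a + t) ≡ a + (B + t)
      f-left zero 0<C rewrite +-identityʳ a | +-identityʳ B = fa≡j 0<C
      f-left (suc t) t<C = begin
        f (a + suc t)     ≡⟨ cong f (+-suc a t) ⟩
        f (suc (a + t))   ≡⟨ consecutive gf f↑ g↑ (a + t)
                               (λ p → <⇒≢ (+-monoʳ-< a t<C) (trans (+-suc a t) p))
                               (inj₁ (subst (j ≤_) (sym IH) (+-monoʳ-≤ a (m≤m+n B t)))) ⟩
        suc (f (a + t))   ≡⟨ cong suc IH ⟩
        suc (a + (B + t)) ≡⟨ trans (cong (a +_) (+-suc B t)) (+-suc a (B + t)) ⟨
        a + (B + suc t)   ∎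
        where
        open ≡-Reasoning
        IH = f-left t (<-trans ≤-refl t<C)

      -- Positions before a hold values below a, and positions from a up to i hold values from j on.
      -- The values in between are left for the positions from i on.
      i≤g : ∀ k → a ≤ k → k < j → i ≤ g k
      i≤g k a≤k k<j = ≮⇒≥ contra
        where
        contra : g k ≮ i
        contra gk<i with g k <? a
        ... | yes gk<a = <⇒≱ gk<a (subst (a ≤_) (trans (sym (fg k)) (fixed (g k) gk<a)) a≤k)
        ... | no  gk≮a with m≤n⇒∃[o]m+o≡n (≮⇒≥ gk≮a)
        ...   | t , eq = <⇒≱ k<j (begin
          a + B       ≤⟨ +-monoʳ-≤ a (m≤m+n B t) ⟩
          a + (B + t) ≡⟨ f-left t (+-cancelˡ-< a t C (subst (_< i) (sym eq) gk<i)) ⟨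
          f (a + t)   ≡⟨ trans (cong f eq) (fg k) ⟩
          k           ∎)
          where open ≤-Reasoning

      -- The argument for `fa≡j` with positions and values exchanged; `i≤g` takes the place of
      -- `large`.
      ga≡i : 0 < B → g a ≡ i
      ga≡i 0<B = trans (cong g (sym (≤-antisym fi≤a a≤fi))) (gf i)
        where
        open ≤-Reasoning
        i≤ga : i ≤ g a
        i≤ga = i≤g a ≤-refl (m<m+n a 0<B)
        fi≤a : f i ≤ a
        fi≤a = begin
          f i               ≤⟨ m≤n+m (f i) (g a ∸ i) ⟩
          g a ∸ i + f i     ≤⟨ ascend f↑ i (g a ∸ i) (inj₁ ≤-refl) ⟩
          f (g a ∸ i + i)   ≡⟨ cong f (m∸n+n≡m i≤ga) ⟩
          f (g a)           ≡⟨ fg a ⟩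
          a                 ∎
        a≤fi : a ≤ f i
        a≤fi = ≮⇒≥ λ fi<a → <⇒≱ (subst (_< a) (trans (sym (g-fixed (f i) fi<a)) (gf i)) fi<a) (m≤m+n a C)

      g-left : ∀ t → t < B → g (a + t) ≡ a + (C + t)
      g-left zero 0<B rewrite +-identityʳ a | +-identityʳ C = ga≡i 0<B
      g-left (suc t) t<B = begin
        g (a + suc t)     ≡⟨ cong g (+-suc a t) ⟩
        g (suc (a + t))   ≡⟨ consecutive fg g↑ f↑ (a + t)
                               (λ p → <⇒≢ (+-monoʳ-< a t<B) (trans (+-suc a t) p))
                               (inj₁ (subst (i ≤_) (sym IH) (+-monoʳ-≤ a (m≤m+n C t)))) ⟩
        suc (g (a + t))   ≡⟨ cong suc IH ⟩
        suc (a + (C + t)) ≡⟨ trans (cong (a +_) (+-suc C t)) (+-suc a (C + t)) ⟨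
        a + (C + suc t)   ∎
        where
        open ≡-Reasoning
        IH = g-left t (<-trans ≤-refl t<B)

      f-right : ∀ t → t < B → f (a + (C + t)) ≡ a + t
      f-right t t<B = trans (cong f (sym (g-left t t<B))) (fg (a + t))

      c+ : ℕ → ℕ
      c+ t = a + (C + (B + t))

      c+-comm : ∀ t → c+ t ≡ a + (B + (C + t))
      c+-comm t = cong (a +_) (trans (sym (+-assoc C B t)) (trans (cong (_+ t) (+-comm C B)) (+-assoc B C t)))

      f< : ∀ {k} → k < c+ 0 → f k < c+ 0
      f< {k} k<c with block a B C k
      ... | before k<a rewrite fixed k k<a = k<c
      ... | left {t} t<C rewrite f-left t t<C | c+-comm 0 | +-identityʳ C = +-monoʳ-< a (+-monoʳ-< B t<C)
      ... | right {t} t<B rewrite f-right t t<B | +-identityʳ B = +-monoʳ-< a (<-≤-trans t<B (m≤n+m B C))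
      ... | after t = ⊥-elim (<⇒≱ k<c (+-monoʳ-≤ a (+-monoʳ-≤ C (+-monoʳ-≤ B z≤n))))

      g< : ∀ {k} → k < c+ 0 → g k < c+ 0
      g< {k} k<c with block a C B k
      ... | before k<a rewrite g-fixed k k<a = k<c
      ... | left {t} t<B rewrite g-left t t<B | +-identityʳ B = +-monoʳ-< a (+-monoʳ-< C t<B)
      ... | right {t} t<C rewrite trans (cong g (sym (f-left t t<C))) (gf (a + t))
                                | c+-comm 0 | +-identityʳ C = +-monoʳ-< a (<-≤-trans t<C (m≤n+m C B))
      ... | after t rewrite sym (c+-comm t) = ⊥-elim (<⇒≱ k<c (+-monoʳ-≤ a (+-monoʳ-≤ C (+-monoʳ-≤ B z≤n))))

      f≥ : ∀ {k} → c+ 0 ≤ k → c+ 0 ≤ f k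
      f≥ {k} c≤k = ≮⇒≥ λ fk<c → <⇒≱ (subst (_< c+ 0) (gf k) (g< fk<c)) c≤k

      g≥ : ∀ {k} → c+ 0 ≤ k → c+ 0 ≤ g k
      g≥ {k} c≤k = ≮⇒≥ λ gk<c → <⇒≱ (subst (_< c+ 0) (fg k) (f< gk<c)) c≤k

      i≤c : i ≤ c+ 0
      i≤c = +-monoʳ-≤ a (m≤m+n C _)

      j≤c : j ≤ c+ 0
      j≤c = subst (j ≤_) (sym (c+-comm 0)) (+-monoʳ-≤ a (m≤m+n B _))

      f-after : ∀ t → f (c+ t) ≡ c+ t
      -- Since g (c+ 0) lies in the tail and f ascends there, f (c+ 0) is at most f (g (c+ 0)),
      -- which is c+ 0.
      f-after zero = ≤-antisym (begin
        f (c+ 0)                  ≤⟨ m≤n+m (f (c+ 0)) (g (c+ 0) ∸ c+ 0) ⟩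
        g (c+ 0) ∸ c+ 0 + f (c+ 0) ≤⟨ ascend f↑ (c+ 0) (g (c+ 0) ∸ c+ 0) (inj₁ i≤c) ⟩
        f (g (c+ 0) ∸ c+ 0 + c+ 0) ≡⟨ cong f (m∸n+n≡m (g≥ ≤-refl)) ⟩
        f (g (c+ 0))              ≡⟨ fg (c+ 0) ⟩
        c+ 0                      ∎) (f≥ ≤-refl)
        where open ≤-Reasoning
      f-after (suc t) = begin
        f (c+ (suc t))   ≡⟨ cong f c+-suc ⟩
        f (suc (c+ t))   ≡⟨ consecutive gf f↑ g↑ (c+ t)
                              (>⇒≢ (s≤s (≤-trans i≤c c≤c+))) (inj₁ (≤-trans j≤c (f≥ c≤c+))) ⟩
        suc (f (c+ t))   ≡⟨ cong suc (f-after t) ⟩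
        suc (c+ t)       ≡⟨ c+-suc ⟨
        c+ (suc t)       ∎
        where
        open ≡-Reasoning
        c≤c+ : c+ 0 ≤ c+ t
        c≤c+ = +-monoʳ-≤ a (+-monoʳ-≤ C (+-monoʳ-≤ B z≤n))
        c+-suc : c+ (suc t) ≡ suc (c+ t)
        c+-suc = trans (cong (λ x → a + (C + x)) (+-suc B t))
                       (trans (cong (a +_) (+-suc C (B + t))) (+-suc a (C + (B + t))))

      f≗blockSwap : f ≗ blockSwap a B C
      f≗blockSwap k with block a B C k
      ... | before k<a = trans (fixed k k<a) (sym (blockSwap-before a B C k<a))
      ... | left t<C   = trans (f-left _ t<C) (sym (blockSwap-left a B C t<C))
      ... | right t<B  = trans (f-right _ t<B) (sym (blockSwap-right a B C t<B))
      ... | after t    = trans (f-after t) (trans (c+-comm t) (sym (blockSwap-after a B C t)))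

  -- `AscendsExceptAt` does not forbid an ascent at the break, so B or C may come out as 0, and f is
  -- then the identity.
  blockSwap-classification : ∀ {i j} → AscendsExceptAt i f → AscendsExceptAt j g →
    ∃ λ a → ∃₂ λ B C → a + C ≡ i × a + B ≡ j × f ≗ blockSwap a B C
  blockSwap-classification {i} {j} f↑ g↑ with firstLarge f j i
  ... | a , a≤i , small , large with m≤n⇒∃[o]m+o≡n a≤i | m≤n⇒∃[o]m+o≡n a≤j
    where
    open ≤-Reasoning
    -- The a prefix values ascend strictly and stay below j, so there are at most j of them.
    bound : ∀ a → a ≤ i → (∀ k → k < a → f k < j) → a ≤ j
    bound zero    _   _     = z≤n
    bound (suc a) a<i small = begin-strict
      a           ≤⟨ m≤m+n a (f 0) ⟩
      a + f 0     ≤⟨ ascend f↑ 0 a (inj₂ (subst (_< i) (sym (+-identityʳ a)) a<i)) ⟩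
      f (a + 0)   ≡⟨ cong f (+-identityʳ a) ⟩
      f a         <⟨ small a ≤-refl ⟩
      j           ∎
    a≤j : a ≤ j
    a≤j = bound a a≤i small
  ... | C , refl | B , refl = a , B , C , refl , refl ,
    Classify.f≗blockSwap a B C f↑ g↑ small (λ 0<C → large (m<m+n a 0<C))

-- Permutations as functions on ℕ

abstract
  -- Extended by the identity from n on, so that every position has a successor and block swaps of ℕ
  -- can be compared with it. All later facts come from `hat-toℕ` and `hat-outside`; the definition
  -- itself stays opaque.
  hat : Permutation′ n → ℕ → ℕ
  hat {n} σ k with k <? n
  ... | yes k<n = toℕ (σ ⟨$⟩ʳ fromℕ< k<n)
  ... | no  _   = k

  hat-toℕ : ∀ (σ : Permutation′ n) i → hat σ (toℕ i) ≡ toℕ (σ ⟨$⟩ʳ i)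
  hat-toℕ {n} σ i with toℕ i <? n
  ... | yes i<n = cong (λ j → toℕ (σ ⟨$⟩ʳ j)) (Fin.fromℕ<-toℕ i i<n)
  ... | no  i≮n = ⊥-elim (i≮n (Fin.toℕ<n i))

  hat-outside : ∀ (σ : Permutation′ n) {k} → n ≤ k → hat σ k ≡ k
  hat-outside {n} σ {k} n≤k with k <? n
  ... | yes k<n = ⊥-elim (<⇒≱ k<n n≤k)
  ... | no  _   = refl

data InRange (n : ℕ) : ℕ → Set where
  inside  : (i : Fin n) → InRange n (toℕ i)
  outside : ∀ {k} → n ≤ k → InRange n k

inRange : ∀ n k → InRange n k
inRange n k with k <? n
... | yes k<n = subst (InRange n) (Fin.toℕ-fromℕ< k<n) (inside (fromℕ< k<n))
... | no  k≮n = outside (≮⇒≥ k≮n)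

hat-flip : ∀ (σ : Permutation′ n) k → hat (flip σ) (hat σ k) ≡ k
hat-flip {n} σ k with inRange n k
... | inside i    rewrite hat-toℕ σ i | hat-toℕ (flip σ) (σ ⟨$⟩ʳ i) = cong toℕ (inverseˡ σ)
... | outside n≤k rewrite hat-outside σ n≤k = hat-outside (flip σ) n≤k

flip-hat : ∀ (σ : Permutation′ n) k → hat σ (hat (flip σ) k) ≡ k
flip-hat σ = hat-flip (flip σ)

hat-injective : ∀ (σ : Permutation′ n) {k l} → hat σ k ≡ hat σ l → k ≡ l
hat-injective σ {k} {l} p = trans (sym (hat-flip σ k)) (trans (cong (hat (flip σ)) p) (hat-flip σ l))

hat-≗⇒≈ : ∀ {σ τ : Permutation′ n} → hat σ ≗ hat τ → σ ≈ τ
hat-≗⇒≈ {σ = σ} {τ} p i = Fin.toℕ-injective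
  (trans (sym (hat-toℕ σ i)) (trans (p (toℕ i)) (hat-toℕ τ i)))

≈⇒hat-≗ : ∀ {σ τ : Permutation′ n} → σ ≈ τ → hat σ ≗ hat τ
≈⇒hat-≗ {n} {σ} {τ} p k with inRange n k
... | inside i    = trans (hat-toℕ σ i) (trans (cong toℕ (p i)) (sym (hat-toℕ τ i)))
... | outside n≤k = trans (hat-outside σ n≤k) (sym (hat-outside τ n≤k))

descent⇒hat : ∀ (σ : Permutation′ n) {i} → IsDescent σ i → hat σ (suc (toℕ i)) < hat σ (toℕ i)
descent⇒hat σ {i} (j , j≡1+i , σj<σi) =
  subst₂ _<_ (trans (sym (hat-toℕ σ j)) (cong (hat σ) j≡1+i)) (sym (hat-toℕ σ i)) σj<σi

-- The extension creates no descent: it is the identity from n on, and the last value inside the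
-- range is below n while the next one is at least n.
hat⇒descent : ∀ (σ : Permutation′ n) {k} → hat σ (suc k) < hat σ k →
              ∃ λ i → toℕ i ≡ k × IsDescent σ i
hat⇒descent {n} σ {k} desc with inRange n k
... | outside n≤k rewrite hat-outside σ n≤k | hat-outside σ (m≤n⇒m≤1+n n≤k) =
  ⊥-elim (<-asym desc ≤-refl)
... | inside i with <-≤-connex (suc (toℕ i)) n
...   | inj₂ n≤i+1 = ⊥-elim (<⇒≱
  (subst₂ _<_ (hat-outside σ n≤i+1) (hat-toℕ σ i) desc)
  (≤-trans (<⇒≤ (Fin.toℕ<n (σ ⟨$⟩ʳ i))) n≤i+1))
...   | inj₁ i+1<n = i , refl , j , Fin.toℕ-fromℕ< i+1<n ,
  subst₂ _<_ (trans (cong (hat σ) (sym (Fin.toℕ-fromℕ< i+1<n))) (hat-toℕ σ j)) (hat-toℕ σ i) desc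
  where j = fromℕ< i+1<n

ascendsExceptAt : ∀ (σ : Permutation′ n) j → (∀ {i} → IsDescent σ i → suc (toℕ i) ≡ j) →
                  AscendsExceptAt j (hat σ)
ascendsExceptAt σ j desc k k+1≢j with <-cmp (hat σ k) (hat σ (suc k))
... | tri< p _ _ = p
... | tri≈ _ p _ = ⊥-elim (<⇒≢ ≤-refl (hat-injective σ p))
... | tri> _ _ p with hat⇒descent σ p
...   | i , refl , d = ⊥-elim (k+1≢j (desc d))

record Exchange (p q : ℕ) (f f′ : ℕ → ℕ) : Set where
  field
    at-p : f′ p ≡ f q
    at-q : f′ q ≡ f p
    rest : ∀ k → k ≢ p → k ≢ q → f′ k ≡ f k

transpose-exchange : ∀ (i j : Fin n) (σ : Permutation′ n) →
                     Exchange (toℕ i) (toℕ j) (hat σ) (hat (transpose i j ∘ₚ σ))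
transpose-exchange {n} i j σ = record { at-p = at-p ; at-q = at-q ; rest = rest }
  where
  τ = transpose i j ∘ₚ σ
  at-p : hat τ (toℕ i) ≡ hat σ (toℕ j)
  at-p rewrite hat-toℕ τ i | hat-toℕ σ j | dec-true (i Fin.≟ i) refl = refl
  at-q : hat τ (toℕ j) ≡ hat σ (toℕ i)
  at-q rewrite hat-toℕ τ j | hat-toℕ σ i with j Fin.≟ i
  ... | yes refl = refl
  ... | no  _ rewrite dec-true (j Fin.≟ j) refl = refl
  rest : ∀ k → k ≢ toℕ i → k ≢ toℕ j → hat τ k ≡ hat σ k
  rest k k≢i k≢j with inRange n k
  ... | outside n≤k = trans (hat-outside τ n≤k) (sym (hat-outside σ n≤k))
  ... | inside l rewrite hat-toℕ τ l | hat-toℕ σ l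
                       | dec-false (l Fin.≟ i) (k≢i ∘ cong toℕ)
                       | dec-false (l Fin.≟ j) (k≢j ∘ cong toℕ) = refl

private
  -- The one-line word as a numeral in base n, first entry leading; it is the termination measure of
  -- `descendToBlockSwap`.
  word : Permutation′ n → Fin (n ^ n)
  word σ = funToFin (σ ⟨$⟩ʳ_)

  funToFin-lex : ∀ {m n} {f g : Fin m → Fin n} (i : Fin m) →
                 g i Fin.< f i → (∀ k → k Fin.< i → g k ≡ f k) → funToFin g Fin.< funToFin f
  funToFin-lex {f = f} {g} Fin.zero    gi<fi _ =
    Fin.combine-monoˡ-< (funToFin (g ∘ Fin.suc)) (funToFin (f ∘ Fin.suc)) gi<fi
  funToFin-lex {f = f} {g} (Fin.suc i) gi<fi eq rewrite eq Fin.zero z<s =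
    subst₂ _<_ (sym (Fin.toℕ-combine (f Fin.zero) _)) (sym (Fin.toℕ-combine (f Fin.zero) _))
      (+-monoʳ-< _ (funToFin-lex i gi<fi (λ k k<i → eq (Fin.suc k) (s<s k<i))))

  word-decreases : ∀ {σ τ : Permutation′ n} → σ ⟶ τ → word τ Fin.< word σ
  word-decreases {σ = σ} (interchange {i} {j} i<j σj<σi) = funToFin-lex i
    (subst₂ _<_ (trans (sym (hat-toℕ σ j)) (trans (sym at-p) (hat-toℕ τ i))) refl σj<σi)
    (λ k k<i → Fin.toℕ-injective (trans (sym (hat-toℕ τ k))
      (trans (rest (toℕ k) (<⇒≢ k<i) (<⇒≢ (<-trans k<i i<j))) (hat-toℕ σ k))))
    where
    τ = transpose i j ∘ₚ σ
    open Exchange (transpose-exchange i j σ)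

-- The rank criterion

indicator : ℕ → ℕ → ℕ
indicator j x with j ≤? x
... | yes _ = 1
... | no  _ = 0

-- Counts the positions before i with value at least j: the rank function by which Bruhat order is
-- usually described.
rank : (ℕ → ℕ) → ℕ → ℕ → ℕ
rank f j zero    = 0
rank f j (suc i) = indicator j (f i) + rank f j i

indicator-≤ : ∀ {j x} → j ≤ x → indicator j x ≡ 1
indicator-≤ {j} {x} p with j ≤? x
... | yes _ = refl
... | no j≰x = ⊥-elim (j≰x p)

indicator-> : ∀ {j x} → x < j → indicator j x ≡ 0
indicator-> {j} {x} p with j ≤? x
... | yes j≤x = ⊥-elim (<⇒≱ p j≤x)
... | no _ = refl

indicator≤1 : ∀ j x → indicator j x ≤ 1
indicator≤1 j x with j ≤? x
... | yes _ = ≤-refl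
... | no  _ = z≤n

indicator-suc : ∀ {j x} → j ≢ suc x → indicator j (suc x) ≡ indicator j x
indicator-suc {j} {x} j≢ with j ≤? x
... | yes j≤x = indicator-≤ (m≤n⇒m≤1+n j≤x)
... | no  j≰x = indicator-> (≤∧≢⇒< (≰⇒> j≰x) (j≢ ∘ sym))

rank-cong : ∀ {f g} j i → (∀ k → k < i → indicator j (f k) ≡ indicator j (g k)) → rank f j i ≡ rank g j i
rank-cong j zero    p = refl
rank-cong j (suc i) p = cong₂ _+_ (p i ≤-refl) (rank-cong j i (λ k k<i → p k (<-trans k<i ≤-refl)))

-- The positions p and suc p are counted both or neither unless i separates them, and only suc p
-- does.
rank-exchange-adjacent : ∀ {p f g} j i → Exchange p (suc p) f g → i ≢ suc p → rank g j i ≡ rank f j i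
rank-exchange-adjacent j zero ex i≢ = refl
rank-exchange-adjacent {p} {f} {g} j (suc i) ex i≢ with i ≟ suc p
... | no i≢1+p = cong₂ _+_ (cong (indicator j) (rest i (i≢ ∘ cong suc) i≢1+p))
                           (rank-exchange-adjacent j i ex i≢1+p)
  where open Exchange ex
... | yes refl rewrite Exchange.at-p ex | Exchange.at-q ex
                     | rank-cong {g} {f} j p (λ k k<p → cong (indicator j)
                         (Exchange.rest ex k (<⇒≢ k<p) (<⇒≢ (<-trans k<p ≤-refl))))
  = trans (sym (+-assoc (indicator j (f p)) _ _))
   (trans (cong (_+ rank f j p) (+-comm (indicator j (f p)) _)) (+-assoc (indicator j (f (suc p))) _ _))

-- Two consecutive values lie on the same side of the threshold j unless j is the larger one, so no
-- indicator changes.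
rank-exchange-values : ∀ {p q f g} j i → Exchange p q f g → f p ≡ suc (f q) → j ≢ f p →
                       rank g j i ≡ rank f j i
rank-exchange-values {p} {q} {f} {g} j i ex fp j≢fp = rank-cong j i λ k _ → same k
  where
  open Exchange ex
  pq : indicator j (f p) ≡ indicator j (f q)
  pq = trans (cong (indicator j) fp) (indicator-suc (λ j≡ → j≢fp (trans j≡ (sym fp))))
  same : ∀ k → indicator j (g k) ≡ indicator j (f k)
  same k with k ≟ p | k ≟ q
  ... | yes refl | _        = trans (cong (indicator j) at-p) (sym pq)
  ... | no _     | yes refl = trans (cong (indicator j) at-q) pq
  ... | no k≢p   | no k≢q   = cong (indicator j) (rest k k≢p k≢q)

-- The case excluded in `rank-exchange-adjacent`: among the counted positions only p changes its
-- value, which costs at most one.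
rank-exchange-drop : ∀ {p f g} j → Exchange p (suc p) f g → rank f j (suc p) ≤ suc (rank g j (suc p))
rank-exchange-drop {p} {f} {g} j ex = +-mono-≤ (indicator≤1 j (f p)) (begin
  rank f j p ≡⟨ rank-cong j p (λ k k<p → cong (indicator j)
                  (Exchange.rest ex k (<⇒≢ k<p) (<⇒≢ (<-trans k<p ≤-refl)))) ⟨
  rank g j p                       ≤⟨ m≤n+m (rank g j p) (indicator j (g p)) ⟩
  indicator j (g p) + rank g j p   ∎)
  where open ≤-Reasoning

rank-mono : ∀ f j {i i′} → i ≤ i′ → rank f j i ≤ rank f j i′
rank-mono f j i≤i′ = go (≤⇒≤′ i≤i′)
  where
  go : ∀ {i i′} → i ≤′ i′ → rank f j i ≤ rank f j i′
  go ≤′-refl         = ≤-refl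
  go (≤′-step i≤′i′) = ≤-trans (go i≤′i′) (m≤n+m _ _)

rank-lower : ∀ f j l m → (∀ t → t < m → j ≤ f (l + t)) → m ≤ rank f j (l + m)
rank-lower f j l zero    _ = z≤n
rank-lower f j l (suc m) p rewrite +-suc l m | indicator-≤ (p m ≤-refl) =
  s≤s (rank-lower f j l m (λ t t<m → p t (<-trans t<m ≤-refl)))

rank-upper : ∀ f j l i → (∀ k → k < l → f k < j) → rank f j i ≤ i ∸ l
rank-upper f j l zero    _ = z≤n
rank-upper f j l (suc i) p with i <? l
... | yes i<l rewrite indicator-> (p i i<l) = ≤-trans (rank-upper f j l i p) (∸-monoˡ-≤ l (n≤1+n i))
... | no  i≮l rewrite +-∸-assoc 1 (≮⇒≥ i≮l) =
  +-mono-≤ (indicator≤1 j (f i)) (rank-upper f j l i p)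

-- A permutation of rank at least C at (a + B , a + C) stays so under every reduction at an
-- adjacent pair of positions other than a + C or of values other than a + B; when none is left,
-- it is a block swap with the same a + B and a + C.
private
  reduceBlockSwap : ∀ a B C (σ : Permutation′ n) → 0 < B → hat σ ≗ blockSwap a B (suc C) →
    ∃ λ τ → σ ⟶ τ × Exchange (a + C) (suc (a + C)) (hat σ) (hat τ)
  reduceBlockSwap a B C σ 0<B σ≗ with hat⇒descent σ
    (subst₂ _<_ (sym (σ≗ (suc (a + C)))) (sym (σ≗ (a + C))) (blockSwap-descends a B C 0<B))
  ... | p , p≡ , q , q≡1+p , σq<σp = transpose p q ∘ₚ σ ,
    interchange (subst (toℕ p <_) (sym q≡1+p) ≤-refl) σq<σp ,
    subst₂ (λ k l → Exchange k l (hat σ) (hat (transpose p q ∘ₚ σ))) p≡ (trans q≡1+p (cong suc p≡)) (transpose-exchange p q σ)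

  descendToBlockSwap : ∀ a B C (σ : Permutation′ n) → Acc Fin._<_ (word σ) →
    C ≤ rank (hat σ) (a + B) (a + C) → ∃ λ τ → Star _⟶_ σ τ × hat τ ≗ blockSwap a B C
  descendToBlockSwap {n} a B C σ (acc rec) C≤rank
    with Fin.any? (λ p → isDescent? σ p ×-dec ¬? (suc (toℕ p) ≟ a + C))
  ... | yes (p , (q , q≡1+p , σq<σp) , p≢) = map₂ (map₁ (step ◅_))
    (descendToBlockSwap a B C τ (rec (word-decreases step))
      (subst (C ≤_) (sym (rank-exchange-adjacent (a + B) (a + C)
        (subst (λ q → Exchange (toℕ p) q (hat σ) (hat τ)) q≡1+p (transpose-exchange p q σ))
        (p≢ ∘ sym))) C≤rank))
    where
    τ = transpose p q ∘ₚ σ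
    step : σ ⟶ τ
    step = interchange (subst (toℕ p <_) (sym q≡1+p) ≤-refl) σq<σp
  ... | no noDescent with Fin.any? (λ v → isDescent? (flip σ) v ×-dec ¬? (suc (toℕ v) ≟ a + B))
  ... | yes (v , (w , w≡1+v , q<p) , v≢) = map₂ (map₁ (step ◅_))
    (descendToBlockSwap a B C τ (rec (word-decreases step))
      (subst (C ≤_) (sym (rank-exchange-values (a + B) (a + C) (transpose-exchange p q σ)
        (trans (trans hat-p w≡1+v) (sym (cong suc hat-q)))
        (λ e → v≢ (sym (trans e (trans hat-p w≡1+v)))))) C≤rank))
    where
    -- The value w = v + 1 stands to the left of v, so exchanging them is a reduction. It can alter
    -- the rank only for the threshold w, which is not a + B.
    p = σ ⟨$⟩ˡ w
    q = σ ⟨$⟩ˡ v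
    τ = transpose p q ∘ₚ σ
    hat-p : hat σ (toℕ p) ≡ toℕ w
    hat-p = trans (hat-toℕ σ p) (cong toℕ (inverseʳ σ))
    hat-q : hat σ (toℕ q) ≡ toℕ v
    hat-q = trans (hat-toℕ σ q) (cong toℕ (inverseʳ σ))
    step : σ ⟶ τ
    step = interchange q<p (subst₂ Fin._<_ (sym (inverseʳ σ)) (sym (inverseʳ σ))
      (subst (toℕ v <_) (sym w≡1+v) ≤-refl))
  ... | no noInvDescent with blockSwap-classification (flip-hat σ) (hat-flip σ)
      (ascendsExceptAt σ (a + C) (λ d → decidable-stable (_ ≟ _) λ ≢ → noDescent (_ , d , ≢)))
      (ascendsExceptAt (flip σ) (a + B) (λ d → decidable-stable (_ ≟ _) λ ≢ → noInvDescent (_ , d , ≢)))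
  ... | a′ , B′ , C′ , C-eq , B-eq , σ≗ with <-cmp a a′
  ... | tri≈ _ refl _ = σ , ε , λ k → trans (σ≗ k) (cong₂ (λ B C → blockSwap a B C k)
    (+-cancelˡ-≡ a B′ B B-eq) (+-cancelˡ-≡ a C′ C C-eq))
  -- A longer fixed prefix contradicts the rank: its values are too small to count, and only C′ < C
  -- positions follow it before a + C.
  ... | tri< a<a′ _ _ = ⊥-elim (<⇒≱ C′<C (begin
    C                              ≤⟨ C≤rank ⟩
    rank (hat σ) (a + B) (a + C)   ≤⟨ rank-upper (hat σ) (a + B) a′ (a + C) small ⟩
    a + C ∸ a′                     ≡⟨ cong (_∸ a′) C-eq ⟨
    a′ + C′ ∸ a′                   ≡⟨ m+n∸m≡n a′ C′ ⟩
    C′                             ∎))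
    where
    open ≤-Reasoning
    C′<C : C′ < C
    C′<C = ≰⇒> λ C≤C′ → <⇒≢ (+-mono-<-≤ a<a′ C≤C′) (sym C-eq)
    small : ∀ k → k < a′ → hat σ k < a + B
    small k k<a′ = begin-strict
      hat σ k                ≡⟨ trans (σ≗ k) (blockSwap-before a′ B′ C′ k<a′) ⟩
      k                      <⟨ k<a′ ⟩
      a′                     ≤⟨ m≤m+n a′ B′ ⟩
      a′ + B′                ≡⟨ B-eq ⟩
      a + B                  ∎
  -- With a shorter prefix both blocks are longer than asked for. The rank is then at least C′ > C,
  -- so the reduction at the break itself is affordable, as it costs at most one.
  ... | tri> _ _ a′<a with C′ | C-eq | σ≗ | ≰⇒> {C′} {C} (λ C′≤C → <⇒≢ (+-mono-<-≤ a′<a C′≤C) C-eq)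
  ...   | suc C″ | C″-eq | σ≗′ | s≤s C≤C″ with reduceBlockSwap a′ B′ C″ σ
          (≤-<-trans z≤n (≰⇒> {B′} {B} (λ B′≤B → <⇒≢ (+-mono-<-≤ a′<a B′≤B) B-eq))) σ≗′
  ...     | τ , step , ex = map₂ (map₁ (step ◅_))
    (descendToBlockSwap a B C τ (rec (word-decreases step)) (≤-trans C≤C″ (s≤s⁻¹ (begin
      suc C″                                ≤⟨ rank-lower (hat σ) (a + B) a′ (suc C″) large ⟩
      rank (hat σ) (a + B) (a′ + suc C″)    ≡⟨ cong (rank (hat σ) (a + B)) (+-suc a′ C″) ⟩
      rank (hat σ) (a + B) (suc (a′ + C″))  ≤⟨ rank-exchange-drop (a + B) ex ⟩
      suc (rank (hat τ) (a + B) (suc (a′ + C″)))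
        ≡⟨ cong (λ i → suc (rank (hat τ) (a + B) i)) (trans (sym (+-suc a′ C″)) C″-eq) ⟩
      suc (rank (hat τ) (a + B) (a + C))    ∎))))
    where
    open ≤-Reasoning
    large : ∀ t → t < suc C″ → a + B ≤ hat σ (a′ + t)
    large t t< = begin
      a + B                          ≡⟨ B-eq ⟨
      a′ + B′                        ≤⟨ +-monoʳ-≤ a′ (m≤m+n B′ t) ⟩
      a′ + (B′ + t)                  ≡⟨ blockSwap-left a′ B′ (suc C″) t< ⟨
      blockSwap a′ B′ (suc C″) (a′ + t) ≡⟨ σ≗′ (a′ + t) ⟨
      hat σ (a′ + t)                 ∎

rank⇒blockSwap-below : ∀ a B C (σ : Permutation′ n) → C ≤ rank (hat σ) (a + B) (a + C) →
                       ∃ λ τ → Star _⟶_ σ τ × hat τ ≗ blockSwap a B C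
rank⇒blockSwap-below a B C σ = descendToBlockSwap a B C σ (Fin.<-wellFounded (word σ))

-- Bruhat order on codes

-- Exchanging an inversion keeps the graph inside any region that is closed under moving
-- right and down, and inside any region closed under moving left and up.
module _ (P : ℕ → ℕ → Set) where
  private
    Inside : Permutation′ n → Set
    Inside σ = ∀ k → P k (hat σ k)

    ≤ᴮ-preserves : (∀ {σ τ : Permutation′ n} → σ ⟶ τ → Inside σ → Inside τ) →
                   ∀ (π σ : Permutation′ n) → π ≤ᴮ σ → Inside σ → Inside π
    ≤ᴮ-preserves {n} step π σ (τ , σ⟶⋆τ , τ≈π) Pσ k =
      subst (P k) (≈⇒hat-≗ {σ = τ} {π} τ≈π k) (go σ⟶⋆τ Pσ k)
      where
      go : ∀ {σ τ : Permutation′ n} → Star _⟶_ σ τ → Inside σ → Inside τ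
      go ε        Pσ = Pσ
      go (s ◅ ss) Pσ = go ss (step s Pσ)

  ≤ᴮ-right-down : (∀ {i j x y} → i ≤ j → y ≤ x → P i x → P j y) →
                  ∀ (π σ : Permutation′ n) → π ≤ᴮ σ → Inside σ → Inside π
  ≤ᴮ-right-down closed = ≤ᴮ-preserves step
    where
    step : ∀ {n} {σ τ : Permutation′ n} → σ ⟶ τ → Inside σ → Inside τ
    step {σ = σ} (interchange {i} {j} i<j σj<σi) Pσ k with k ≟ toℕ i | k ≟ toℕ j
    -- Both new points come from the old point (i , σ i): one lies straight below it, the other
    -- straight to its right.
    ... | yes refl | _ = closed ≤-refl
      (subst₂ _≤_ (trans (sym (hat-toℕ σ j)) (sym at-p)) (sym (hat-toℕ σ i)) (<⇒≤ σj<σi)) (Pσ (toℕ i))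
      where open Exchange (transpose-exchange i j σ)
    ... | no _ | yes refl = closed (<⇒≤ i<j) (≤-reflexive at-q) (Pσ (toℕ i))
      where open Exchange (transpose-exchange i j σ)
    ... | no k≢i | no k≢j = subst (P k) (sym (rest k k≢i k≢j)) (Pσ k)
      where open Exchange (transpose-exchange i j σ)

  ≤ᴮ-left-up : (∀ {i j x y} → j ≤ i → x ≤ y → P i x → P j y) →
               ∀ (π σ : Permutation′ n) → π ≤ᴮ σ → Inside σ → Inside π
  ≤ᴮ-left-up closed = ≤ᴮ-preserves step
    where
    step : ∀ {n} {σ τ : Permutation′ n} → σ ⟶ τ → Inside σ → Inside τ
    step {σ = σ} (interchange {i} {j} i<j σj<σi) Pσ k with k ≟ toℕ i | k ≟ toℕ j
    -- Here both new points come from (j , σ j), one straight to its left and one straight above it.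
    ... | yes refl | _ = closed (<⇒≤ i<j) (≤-reflexive (sym at-p)) (Pσ (toℕ j))
      where open Exchange (transpose-exchange i j σ)
    ... | no _ | yes refl = closed ≤-refl
      (subst₂ _≤_ (sym (hat-toℕ σ j)) (trans (sym (hat-toℕ σ i)) (sym at-q)) (<⇒≤ σj<σi)) (Pσ (toℕ j))
      where open Exchange (transpose-exchange i j σ)
    ... | no k≢i | no k≢j = subst (P k) (sym (rest k k≢i k≢j)) (Pσ k)
      where open Exchange (transpose-exchange i j σ)

-- ((a , d) , (u , v)) stands for the block swap fixing the first a and the last d points and
-- interchanging blocks of lengths v + 1 and u + 1.
Code : Set
Code = (ℕ × ℕ) × (ℕ × ℕ)

total : Code → ℕ
total ((a , d) , (u , v)) = (a + d) + (u + v)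

infix 4 _≼_
_≼_ : Code → Code → Set
((a , d) , (u , v)) ≼ ((a′ , d′) , (u′ , v′)) = (a′ ≤ a × d′ ≤ d) × (u ≤ u′ × v ≤ v′)

≼-antisym : ∀ {s t} → s ≼ t → t ≼ s → s ≡ t
≼-antisym ((a , d) , (u , v)) ((a′ , d′) , (u′ , v′)) =
  cong₂ _,_ (cong₂ _,_ (≤-antisym a′ a) (≤-antisym d′ d)) (cong₂ _,_ (≤-antisym u u′) (≤-antisym v v′))

-- `blockSwap` does not see the end of the range; it is `total≡` that fixes d.
record Represents {n} (σ : Permutation′ n) (t : Code) : Set where
  constructor represents
  private
    a = proj₁ (proj₁ t)
    u = proj₁ (proj₂ t)
    v = proj₂ (proj₂ t)
  field
    total≡ : 2 + total t ≡ n
    hat≗   : hat σ ≗ blockSwap a (suc u) (suc v)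

open Represents

module _ {ω : Permutation′ n} {a d u v} (R : Represents ω ((a , d) , (u , v))) where
  private
    B = suc u
    C = suc v
    ω≗ = hat≗ R

  represents-before : ∀ {k} → k < a → hat ω k ≡ k
  represents-before k<a = trans (ω≗ _) (blockSwap-before a B C k<a)

  represents-left : ∀ {t} → t < C → hat ω (a + t) ≡ a + (B + t)
  represents-left t<C = trans (ω≗ _) (blockSwap-left a B C t<C)

  represents-right : ∀ {t} → t < B → hat ω (a + (C + t)) ≡ a + t
  represents-right t<B = trans (ω≗ _) (blockSwap-right a B C t<B)

  represents-after : ∀ t → hat ω (a + (C + (B + t))) ≡ a + (C + (B + t))
  represents-after t = trans (ω≗ _) (trans (blockSwap-after a B C t)
    (cong (a +_) (trans (sym (+-assoc B C t)) (trans (cong (_+ t) (+-comm B C)) (+-assoc C B t)))))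

-- All points of ω are at most B′ above the diagonal and at most C′ below it, and they are on the
-- diagonal before a′ and from a′ + C′ + B′ on. Each of these facts, relaxed to one side of the
-- diagonal, gives a region inherited by π. The regions are tested at the first moved position of π,
-- which lies B above the diagonal, and at the last one, which lies C below.
≤ᴮ⇒≼ : ∀ {π ω : Permutation′ n} {s t} → Represents π s → Represents ω t → π ≤ᴮ ω → s ≼ t
≤ᴮ⇒≼ {π = π} {ω} {(a , d) , (u , v)} {(a′ , d′) , (u′ , v′)} Rπ Rω π≤ω = (a′≤a , d′≤d) , (u≤u′ , v≤v′)
  where
  open ≤-Reasoning
  B = suc u ; C = suc v ; B′ = suc u′ ; C′ = suc v′

  first : hat π a ≡ a + B
  first = subst₂ (λ k l → hat π k ≡ a + l) (+-identityʳ a) (+-identityʳ B) (represents-left Rπ {0} z<s)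

  last : hat π (a + (C + u)) ≡ a + u
  last = represents-right Rπ ≤-refl

  a′≤a : a′ ≤ a
  a′≤a = ≮⇒≥ λ a<a′ → m+n≮m a u (≤-trans (≤-reflexive (trans (sym (+-suc a u)) (sym first))) (low a a<a′))
    where
    low : ∀ k → k < a′ → hat π k ≤ k
    low = ≤ᴮ-right-down (λ k x → k < a′ → x ≤ k)
      (λ i≤j y≤x U j<a′ → ≤-trans y≤x (≤-trans (U (≤-<-trans i≤j j<a′)) i≤j)) π ω
      π≤ω (λ k k<a′ → ≤-reflexive (represents-before Rω k<a′))

  u≤u′ : u ≤ u′
  u≤u′ = s≤s⁻¹ (+-cancelˡ-≤ a B B′ (subst₂ _≤_ first (+-comm B′ a) (low a)))
    where
    low : ∀ k → hat π k ≤ B′ + k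
    low = ≤ᴮ-right-down (λ k x → x ≤ B′ + k)
      (λ i≤j y≤x U → ≤-trans y≤x (≤-trans U (+-monoʳ-≤ B′ i≤j))) π ω π≤ω base
      where
      base : ∀ k → hat ω k ≤ B′ + k
      base k with block a′ B′ C′ k
      ... | before k<a rewrite represents-before Rω k<a = m≤n+m k B′
      ... | left {t} t<C rewrite represents-left Rω t<C = ≤-reflexive (solve-+ a′ B′ t)
        where solve-+ : ∀ a b t → a + (b + t) ≡ b + (a + t)
              solve-+ = solve-∀
      ... | right {t} t<B rewrite represents-right Rω t<B =
        ≤-trans (+-monoʳ-≤ a′ (m≤n+m t C′)) (m≤n+m _ B′)
      ... | after t rewrite represents-after Rω t = m≤n+m _ B′

  v≤v′ : v ≤ v′
  v≤v′ = s≤s⁻¹ (+-cancelʳ-≤ (a + u) C C′ (begin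
      C + (a + u)                   ≡⟨ solve-+ C a u ⟩
      a + (C + u)                   ≤⟨ low (a + (C + u)) ⟩
      C′ + hat π (a + (C + u))      ≡⟨ cong (C′ +_) last ⟩
      C′ + (a + u)                  ∎))
    where
    solve-+ : ∀ c a u → c + (a + u) ≡ a + (c + u)
    solve-+ = solve-∀
    low : ∀ k → k ≤ C′ + hat π k
    low = ≤ᴮ-left-up (λ k x → k ≤ C′ + x)
      (λ j≤i x≤y L → ≤-trans j≤i (≤-trans L (+-monoʳ-≤ C′ x≤y))) π ω π≤ω base
      where
      base : ∀ k → k ≤ C′ + hat ω k
      base k with block a′ B′ C′ k
      ... | before k<a rewrite represents-before Rω k<a = m≤n+m k C′
      ... | left {t} t<C rewrite represents-left Rω t<C =
        ≤-trans (+-monoʳ-≤ a′ (m≤n+m t B′)) (m≤n+m _ C′)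
      ... | right {t} t<B rewrite represents-right Rω t<B = ≤-reflexive (sym (solve-+ C′ a′ t))
      ... | after t rewrite represents-after Rω t = m≤n+m _ C′

  d′≤d : d′ ≤ d
  d′≤d = +-cancelˡ-≤ (a + (C + B)) d′ d (begin
    a + (C + B) + d′                  ≡⟨ cong (λ x → a + x + d′) (+-suc C u) ⟩
    a + suc (C + u) + d′              ≡⟨ cong (_+ d′) (+-suc a (C + u)) ⟩
    suc (a + (C + u)) + d′            ≤⟨ +-monoˡ-≤ d′ (≰⇒> moved) ⟩
    a′ + (C′ + B′) + d′               ≡⟨ regroup a′ d′ u′ v′ ⟩
    2 + total ((a′ , d′) , (u′ , v′)) ≡⟨ trans (total≡ Rω) (sym (total≡ Rπ)) ⟩
    2 + total ((a , d) , (u , v))     ≡⟨ regroup a d u v ⟨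
    a + (C + B) + d                   ∎)
    where
    regroup : ∀ a d u v → a + (suc v + suc u) + d ≡ 2 + ((a + d) + (u + v))
    regroup = solve-∀
    low : ∀ k → a′ + (C′ + B′) ≤ k → k ≤ hat π k
    low = ≤ᴮ-left-up (λ k x → a′ + (C′ + B′) ≤ k → k ≤ x)
      (λ j≤i x≤y L c≤j → ≤-trans j≤i (≤-trans (L (≤-trans c≤j j≤i)) x≤y)) π ω
      π≤ω base
      where
      base : ∀ k → a′ + (C′ + B′) ≤ k → k ≤ hat ω k
      base k c≤k with m≤n⇒∃[o]m+o≡n c≤k
      ... | t , refl = ≤-reflexive (sym (subst (λ k → hat ω k ≡ k)
        (sym (trans (+-assoc a′ (C′ + B′) t) (cong (a′ +_) (+-assoc C′ B′ t)))) (represents-after Rω t)))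
    moved : ¬ (a′ + (C′ + B′) ≤ a + (C + u))
    moved p = <⇒≱ (+-monoʳ-< a (m<n+m u {C} z<s)) (subst (a + (C + u) ≤_) last (low _ p))

≼⇒≤ᴮ : ∀ {π ω : Permutation′ n} {s t} → Represents π s → Represents ω t → s ≼ t → π ≤ᴮ ω
≼⇒≤ᴮ {π = π} {ω} {(a , d) , (u , v)} {(a′ , d′) , (u′ , v′)} Rπ Rω ((a′≤a , d′≤d) , (u≤u′ , v≤v′))
  with m≤n⇒∃[o]m+o≡n a′≤a | m≤n⇒∃[o]m+o≡n d′≤d | m≤n⇒∃[o]m+o≡n u≤u′ | m≤n⇒∃[o]m+o≡n v≤v′
... | p , refl | z , refl | x , refl | y , refl
  with rank⇒blockSwap-below (a′ + p) (suc u) (suc v) ω highRank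
  where
  open ≤-Reasoning
  -- The C high positions of ω start at a′ + q in its left block. There x + q ≥ p makes the values
  -- reach a + B, and q ≤ p keeps the positions before a + C. Equal totals give p + z ≡ x + y, hence
  -- q ≤ y, so the positions fit into the left block.
  q = p ∸ x

  balance : p ≤ x + y
  balance = ≤-trans (m≤m+n p z) (≤-reflexive (+-cancelˡ-≡ (a′ + d′ + u + v) (p + z) (x + y)
    (trans (eq₁ a′ d′ u v p z) (trans (suc-injective (suc-injective (trans (total≡ Rπ) (sym (total≡ Rω))))) (eq₂ a′ d′ u v x y)))))
    where
    eq₁ : ∀ a d u v p z → a + d + u + v + (p + z) ≡ (a + p) + (d + z) + (u + v)
    eq₁ = solve-∀
    eq₂ : ∀ a d u v x y → (a + d) + ((u + x) + (v + y)) ≡ a + d + u + v + (x + y)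
    eq₂ = solve-∀

  high : ∀ t → t < suc v → a′ + p + suc u ≤ hat ω (a′ + q + t)
  high t t<C = begin
    a′ + p + suc u                  ≤⟨ +-monoˡ-≤ (suc u) (+-monoʳ-≤ a′ (m≤n+m∸n p x)) ⟩
    a′ + (x + q) + suc u            ≡⟨ eq a′ x q u ⟩
    a′ + (suc (u + x) + q)          ≤⟨ +-monoʳ-≤ a′ (+-monoʳ-≤ (suc (u + x)) (m≤m+n q t)) ⟩
    a′ + (suc (u + x) + (q + t))    ≡⟨ represents-left Rω (<-≤-trans (+-monoʳ-< q t<C)
                                         (≤-trans (+-monoˡ-≤ (suc v) (m≤n+o⇒m∸n≤o p x balance))
                                                  (≤-reflexive (eq′ y v)))) ⟨
    hat ω (a′ + (q + t))            ≡⟨ cong (hat ω) (+-assoc a′ q t) ⟨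
    hat ω (a′ + q + t)              ∎
    where
    eq : ∀ a x q u → a + (x + q) + suc u ≡ a + (suc (u + x) + q)
    eq = solve-∀
    eq′ : ∀ y v → y + suc v ≡ suc (v + y)
    eq′ = solve-∀

  highRank : suc v ≤ rank (hat ω) (a′ + p + suc u) (a′ + p + suc v)
  highRank = ≤-trans (rank-lower (hat ω) (a′ + p + suc u) (a′ + q) (suc v) high)
    (rank-mono (hat ω) (a′ + p + suc u) (+-monoˡ-≤ (suc v) (+-monoʳ-≤ a′ (m∸n≤m p x))))
... | τ , ω⟶⋆τ , τ≗ = τ , ω⟶⋆τ , hat-≗⇒≈ {σ = τ} {π} (λ k → trans (τ≗ k) (sym (hat≗ Rπ k)))

-- Codes of bigrassmannian permutations

represents-functional : ∀ {π σ : Permutation′ n} {t} → Represents π t → Represents σ t → π ≈ σ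
represents-functional {π = π} {σ} (represents _ π≗) (represents _ σ≗) = hat-≗⇒≈ {σ = π} {σ} λ k → trans (π≗ k) (sym (σ≗ k))

-- Uniqueness of the code falls out of the order: σ ≤ᴮ σ compares the two codes in both directions.
represents-injective : ∀ {σ : Permutation′ n} {s t} → Represents σ s → Represents σ t → s ≡ t
represents-injective {σ = σ} Rs Rt = ≼-antisym (≤ᴮ⇒≼ Rs Rt σ≤σ) (≤ᴮ⇒≼ Rt Rs σ≤σ)
  where
  σ≤σ : σ ≤ᴮ σ
  σ≤σ = σ , ε , λ _ → refl

blockSwap-bounded : ∀ a B C {m k} → a + (C + B) ≤ m → k < m → blockSwap a B C k < m
blockSwap-bounded a B C {m} {k} c≤m k<m with block a B C k
... | before k<a rewrite blockSwap-before a B C k<a = k<m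
... | left {t} t<C rewrite blockSwap-left a B C t<C | +-comm C B =
  <-≤-trans (+-monoʳ-< a (+-monoʳ-< B t<C)) c≤m
... | right {t} t<B rewrite blockSwap-right a B C t<B =
  <-≤-trans (+-monoʳ-< a (<-≤-trans t<B (m≤n+m B C))) c≤m
... | after t rewrite blockSwap-after a B C t = subst (_< m) (eq a B C t) k<m
  where
  eq : ∀ a b c t → a + (c + (b + t)) ≡ a + (b + (c + t))
  eq = solve-∀

bounded⇒hat : ∀ {f g : ℕ → ℕ} → (∀ k → f (g k) ≡ k) → (∀ k → g (f k) ≡ k) →
              (∀ {k} → k < n → f k < n) → (∀ {k} → k < n → g k < n) →
              ∃ λ (σ : Permutation′ n) → ∀ (i : Fin n) → hat σ (toℕ i) ≡ f (toℕ i)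
bounded⇒hat {n} {f} {g} fg gf f< g< =
  σ , λ i → trans (hat-toℕ σ i) (Fin.toℕ-fromℕ< (f< (Fin.toℕ<n i)))
  where
  restrict : (f : ℕ → ℕ) → (∀ {k} → k < n → f k < n) → Fin n → Fin n
  restrict f f< i = fromℕ< (f< (Fin.toℕ<n i))
  inverse : ∀ {f g} → (∀ k → f (g k) ≡ k) →
    (f< : ∀ {k} → k < n → f k < n) (g< : ∀ {k} → k < n → g k < n) →
    ∀ i → restrict f f< (restrict g g< i) ≡ i
  inverse {f} {g} fg f< g< i = Fin.toℕ-injective (trans (Fin.toℕ-fromℕ< (f< (Fin.toℕ<n (restrict g g< i))))
    (trans (cong f (Fin.toℕ-fromℕ< (g< (Fin.toℕ<n i)))) (fg (toℕ i))))
  σ : Permutation′ n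
  σ = permutation (restrict f f<) (restrict g g<) (inverse fg f< g<) (inverse gf g< f<)

blockSwap-beyond : ∀ a B C {k} → a + (C + B) ≤ k → blockSwap a B C k ≡ k
blockSwap-beyond a B C c≤k with m≤n⇒∃[o]m+o≡n c≤k
... | r , refl = begin
    blockSwap a B C (a + (C + B) + r)   ≡⟨ cong (blockSwap a B C) (eq a C B r) ⟩
    blockSwap a B C (a + (C + (B + r))) ≡⟨ blockSwap-after a B C r ⟩
    a + (B + (C + r))                   ≡⟨ eq′ a B C r ⟩
    a + (C + B) + r                     ∎
    where
    open ≡-Reasoning
    eq : ∀ a c b r → a + (c + b) + r ≡ a + (c + (b + r))
    eq = solve-∀
    eq′ : ∀ a b c r → a + (b + (c + r)) ≡ a + (c + b) + r
    eq′ = solve-∀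

represented : ∀ t → 2 + total t ≡ n → ∃ λ (σ : Permutation′ n) → Represents σ t
represented {n} ((a , d) , (u , v)) t≡n
  = σ , represents t≡n λ k → σ≗ k (inRange (n) k)
  where
  B = suc u
  C = suc v
  size : ∀ a d u v → a + (suc v + suc u) + d ≡ 2 + ((a + d) + (u + v))
  size = solve-∀
  c≤n : a + (C + B) ≤ n
  c≤n = ≤-trans (m≤m+n _ d) (≤-reflexive (trans (size a d u v) t≡n))
  restricted = bounded⇒hat (blockSwap-inverse a C B) (blockSwap-inverse a B C)
    (blockSwap-bounded a B C c≤n)
    (blockSwap-bounded a C B (subst (λ x → a + x ≤ n) (+-comm C B) c≤n))
  σ : Permutation′ n
  σ = proj₁ restricted
  σ≗ : ∀ k → InRange (n) k → hat σ k ≡ blockSwap a B C k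
  σ≗ k (inside i)    = proj₂ restricted i
  σ≗ k (outside n≤k) = trans (hat-outside σ n≤k) (sym (blockSwap-beyond a _ _ (≤-trans c≤n n≤k)))

blockSwap⇒hasOneDescent : ∀ (σ : Permutation′ n) a u v → hat σ ≗ blockSwap a (suc u) (suc v) → HasOneDescent σ
blockSwap⇒hasOneDescent σ a u v σ≗
  with hat⇒descent σ (subst₂ _<_ (sym (σ≗ (suc (a + v)))) (sym (σ≗ (a + v))) (blockSwap-descends a (suc u) v z<s))
... | i , i≡ , desc = i , desc , λ {j} desc′ → Fin.toℕ-injective (trans i≡ (suc-injective (sym (unique j desc′))))
  where
  unique : ∀ j → IsDescent σ j → suc (toℕ j) ≡ suc (a + v)
  unique j desc′ with suc (toℕ j) ≟ suc (a + v)
  ... | yes p = p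
  ... | no  p = ⊥-elim (<-asym (descent⇒hat σ desc′)
    (subst₂ _<_ (sym (σ≗ (toℕ j))) (sym (σ≗ (suc (toℕ j))))
      (blockSwap-ascends a (suc u) (suc v) (toℕ j) (λ q → p (trans q (+-suc a v))))))

represents⇒bigrassmannian : ∀ {σ : Permutation′ n} {t} → Represents σ t → IsBigrassmannian σ
represents⇒bigrassmannian {σ = σ} {(a , d) , (u , v)} (represents _ σ≗) =
  blockSwap⇒hasOneDescent σ a u v σ≗ , blockSwap⇒hasOneDescent (flip σ) a v u flip≗
  where
  open ≡-Reasoning
  B = suc u
  C = suc v
  flip≗ : hat (flip σ) ≗ blockSwap a C B
  flip≗ k = begin
    hat (flip σ) k                                   ≡⟨ cong (hat (flip σ)) (blockSwap-inverse a C B k) ⟨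
    hat (flip σ) (blockSwap a B C (blockSwap a C B k)) ≡⟨ cong (hat (flip σ)) (σ≗ _) ⟨
    hat (flip σ) (hat σ (blockSwap a C B k))         ≡⟨ hat-flip σ _ ⟩
    blockSwap a C B k                                ∎

blockSwap-emptyʳ : ∀ a B k → blockSwap a B 0 k ≡ k
blockSwap-emptyʳ a B k with block a B 0 k
... | before k<a = blockSwap-before a B 0 k<a
... | right t<B  = blockSwap-right a B 0 t<B
... | after t    = blockSwap-after a B 0 t

blockSwap-emptyˡ : ∀ a C k → blockSwap a 0 C k ≡ k
blockSwap-emptyˡ a C k = trans (cong (blockSwap a 0 C) (sym (blockSwap-emptyʳ a C k))) (blockSwap-inverse a C 0 k)

hasOneDescent⇒ascends : ∀ (σ : Permutation′ n) ((i , _) : HasOneDescent σ) → AscendsExceptAt (suc (toℕ i)) (hat σ)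
hasOneDescent⇒ascends σ (i , _ , unique) =
  ascendsExceptAt σ (suc (toℕ i)) (λ d → cong (suc ∘ toℕ) (sym (unique d)))

bigrassmannian⇒represents : ∀ {σ : Permutation′ n} → IsBigrassmannian σ → ∃ (Represents σ)
bigrassmannian⇒represents {n} {σ} (desc@(i , di , _) , desc′)
  with blockSwap-classification (flip-hat σ) (hat-flip σ)
         (hasOneDescent⇒ascends σ desc) (hasOneDescent⇒ascends (flip σ) desc′)
-- An empty block makes σ the identity, which has no descent.
... | a , B , zero , _ , _ , σ≗ = ⊥-elim (<-asym (descent⇒hat σ di)
  (subst₂ _<_ (sym (trans (σ≗ _) (blockSwap-emptyʳ a B _))) (sym (trans (σ≗ _) (blockSwap-emptyʳ a B _))) ≤-refl))
... | a , zero , C , _ , _ , σ≗ = ⊥-elim (<-asym (descent⇒hat σ di)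
  (subst₂ _<_ (sym (trans (σ≗ _) (blockSwap-emptyˡ a C _))) (sym (trans (σ≗ _) (blockSwap-emptyˡ a C _))) ≤-refl))
... | a , suc u , suc v , _ , _ , σ≗ with m≤n⇒∃[o]m+o≡n last<n
  where
  -- The last position of the right block is moved, hence inside the range; d is the number of
  -- positions after it.
  last<n : a + (suc v + u) < n
  last<n = ≰⇒> λ n≤ → <⇒≢ (+-monoʳ-< a (m<n+m u {suc v} z<s))
    (trans (sym (trans (σ≗ _) (blockSwap-right a (suc u) (suc v) ≤-refl))) (hat-outside σ n≤))
... | d , eq = ((a , d) , (u , v)) , represents (trans (regroup a d u v) eq) σ≗
  where
  regroup : ∀ a d u v → 2 + ((a + d) + (u + v)) ≡ suc (a + (suc v + u)) + d
  regroup = solve-∀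

-- Counting

sumOver : List A → (A → ℕ) → ℕ
sumOver xs f = sum (map f xs)

sumOver-cong : ∀ {f g : A → ℕ} xs → f ≗ g → sumOver xs f ≡ sumOver xs g
sumOver-cong xs f≗g = cong sum (map-cong f≗g xs)

sumOver-map : ∀ (f : A′ → ℕ) (h : A → A′) xs → sumOver (map h xs) f ≡ sumOver xs (f ∘ h)
sumOver-map f h xs = cong sum (sym (map-∘ xs))

sumOver-*ˡ : ∀ c (f : A → ℕ) xs → c * sumOver xs f ≡ sumOver xs (λ x → c * f x)
sumOver-*ˡ c f []       = *-zeroʳ c
sumOver-*ˡ c f (x ∷ xs) = trans (*-distribˡ-+ c (f x) _) (cong (c * f x +_) (sumOver-*ˡ c f xs))

sumOver-const : ∀ c (xs : List A) → sumOver xs (const c) ≡ length xs * c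
sumOver-const c []       = refl
sumOver-const c (x ∷ xs) = cong (c +_) (sumOver-const c xs)

length≡sumOver : ∀ (xs : List A) → length xs ≡ sumOver xs (const 1)
length≡sumOver xs = trans (sym (*-identityʳ _)) (sym (sumOver-const 1 xs))

module _ {R : A → A′ → Set} (injective : ∀ {x y y′} → R x y → R x y′ → y ≡ y′) where

  -- A bijection given by a relation: the entries of `𝔅 n` are distinct up to `_≈_`, which here
  -- takes the form that no two of them share a partner. The induction removes the partner of the
  -- head from wherever it stands in ys.
  sumOver-matching : ∀ {xs ys} {f : A → ℕ} {g : A′ → ℕ} →
    AllPairs (λ x x′ → ∀ {y} → R x y → ¬ R x′ y) xs → Unique ys →
    (∀ {x} → x ∈ xs → ∃ λ y → y ∈ ys × R x y) →
    (∀ {y} → y ∈ ys → ∃ λ x → x ∈ xs × R x y) →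
    (∀ {x y} → R x y → f x ≡ g y) →
    sumOver xs f ≡ sumOver ys g
  sumOver-matching {[]} {[]}     _ _ _ _ _ = refl
  sumOver-matching {[]} {y ∷ ys} _ _ _ back _ with back (here refl)
  ... | _ , () , _
  sumOver-matching {x ∷ xs} {ys} {f} {g} (x# ∷ xs#) ysU forth back fg with forth (here refl)
  ... | y , y∈ys , Rxy with ∈-∃++ y∈ys
  ... | ys₁ , ys₂ , refl = trans
    (cong₂ _+_ (fg Rxy) (sumOver-matching xs# (tailU yysU) forth′ back′ fg))
    (sym (sum-↭ (map⁺ g perm)))
    where
    perm : ys ↭ y ∷ ys₁ ++ ys₂
    perm = ↭-shift y ys₁ ys₂
    yysU : Unique (y ∷ ys₁ ++ ys₂)
    yysU = SetoidPermutation.Unique-resp-↭ (setoid A′) (↭⇒↭ₛ perm) ysU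
    tailU : ∀ {y ys} → Unique (y ∷ ys) → Unique ys
    tailU (_ ∷ u) = u
    forth′ : ∀ {x′} → x′ ∈ xs → ∃ λ y′ → y′ ∈ ys₁ ++ ys₂ × R x′ y′
    forth′ x′∈ with forth (there x′∈)
    ... | y′ , y′∈ , Rx′y′ with ∈-resp-↭ perm y′∈
    ...   | here refl = ⊥-elim (All.lookup x# x′∈ Rxy Rx′y′)
    ...   | there y′∈′ = y′ , y′∈′ , Rx′y′
    back′ : ∀ {y′} → y′ ∈ ys₁ ++ ys₂ → ∃ λ x′ → x′ ∈ xs × R x′ y′
    back′ y′∈ with back (∈-resp-↭ (↭-sym perm) (there y′∈))
    ... | x′ , there x′∈ , Rx′y′ = x′ , x′∈ , Rx′y′
    ... | x′ , here refl , Rxy′ = ⊥-elim (Unique.Unique[x∷xs]⇒x∉xs yysU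
      (subst (_∈ ys₁ ++ ys₂) (sym (injective Rxy Rxy′)) y′∈))

infixr 5 _⊗_
_⊗_ : List A → (A → List A′) → List (A × A′)
[]       ⊗ f = []
(x ∷ xs) ⊗ f = map (x ,_) (f x) ++ (xs ⊗ f)

∈-⊗⁺ : ∀ {xs} {f : A → List A′} {x y} → x ∈ xs → y ∈ f x → (x , y) ∈ xs ⊗ f
∈-⊗⁺ (here refl) y∈ = ∈-++⁺ˡ (∈-map⁺ _ y∈)
∈-⊗⁺ {f = f} (there {x = z} x∈) y∈ = ∈-++⁺ʳ (map (z ,_) (f z)) (∈-⊗⁺ x∈ y∈)

∈-⊗⁻ : ∀ xs {f : A → List A′} {x y} → (x , y) ∈ xs ⊗ f → x ∈ xs × y ∈ f x
∈-⊗⁻ (z ∷ xs) {f} p with ∈-++⁻ (map (z ,_) (f z)) p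
... | inj₂ q = map₁ there (∈-⊗⁻ xs q)
... | inj₁ q with ∈-map⁻ (z ,_) q
...   | _ , y∈ , refl = here refl , y∈

⊗-unique : ∀ {xs} {f : A → List A′} → Unique xs → (∀ x → Unique (f x)) → Unique (xs ⊗ f)
⊗-unique []             _  = []
⊗-unique {xs = x ∷ xs} {f} (x∉ ∷ xsU) fU = Unique.++⁺ (Unique.map⁺ ,-injectiveʳ (fU x)) (⊗-unique xsU fU) disjoint
  where
  disjoint : ∀ {z} → ¬ (z ∈ map (x ,_) (f x) × z ∈ xs ⊗ f)
  disjoint (p , q) with ∈-map⁻ (x ,_) p
  ... | _ , _ , refl = All.lookup x∉ (proj₁ (∈-⊗⁻ xs q)) refl

sumOver-⊗ : ∀ xs {f : A → List A′} (h : A × A′ → ℕ) →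
            sumOver (xs ⊗ f) h ≡ sumOver xs (λ x → sumOver (f x) (λ y → h (x , y)))
sumOver-⊗ []       h = refl
sumOver-⊗ (x ∷ xs) {f} h = begin
  sum (map h (map (x ,_) (f x) ++ (xs ⊗ f)))         ≡⟨ cong sum (map-++ h (map (x ,_) (f x)) (xs ⊗ f)) ⟩
  sum (map h (map (x ,_) (f x)) ++ map h (xs ⊗ f))   ≡⟨ sum-++ (map h (map (x ,_) (f x))) _ ⟩
  sumOver (map (x ,_) (f x)) h + sumOver (xs ⊗ f) h  ≡⟨ cong₂ _+_ (sumOver-map h (x ,_) (f x)) (sumOver-⊗ xs h) ⟩
  sumOver (f x) (λ y → h (x , y)) + _                ∎
  where open ≡-Reasoning

map-unique : ∀ {f : A → A′} {xs} → (∀ {x y} → x ∈ xs → y ∈ xs → f x ≡ f y → x ≡ y) →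
             Unique xs → Unique (map f xs)
map-unique inj []         = []
map-unique inj (x∉ ∷ xsU) =
  All.map⁺ (All.tabulate (λ y∈ fx≡fy → All.lookup x∉ y∈ (inj (here refl) (there y∈) fx≡fy)))
  ∷ map-unique (λ p q → inj (there p) (there q)) xsU

-- Enumeration of codes and of the codes below one

antidiagonal : ℕ → List (ℕ × ℕ)
antidiagonal zero    = (0 , 0) ∷ []
antidiagonal (suc k) = (0 , suc k) ∷ map (map₁ suc) (antidiagonal k)

∈-antidiagonal⁺ : ∀ {k i j} → i + j ≡ k → (i , j) ∈ antidiagonal k
∈-antidiagonal⁺ {zero}  {zero}  refl = here refl
∈-antidiagonal⁺ {suc k} {zero}  refl = here refl
∈-antidiagonal⁺ {suc k} {suc i} p    = there (∈-map⁺ (map₁ suc) (∈-antidiagonal⁺ (suc-injective p)))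

∈-antidiagonal⁻ : ∀ k {i j} → (i , j) ∈ antidiagonal k → i + j ≡ k
∈-antidiagonal⁻ zero    (here refl) = refl
∈-antidiagonal⁻ (suc k) (here refl) = refl
∈-antidiagonal⁻ (suc k) (there p) with ∈-map⁻ (map₁ suc) p
... | _ , q , refl = cong suc (∈-antidiagonal⁻ k q)

antidiagonal-unique : ∀ k → Unique (antidiagonal k)
antidiagonal-unique zero    = [] ∷ []
antidiagonal-unique (suc k) =
  All.map⁺ (All.universal (λ _ ()) (antidiagonal k)) ∷
  Unique.map⁺ (λ { {_ , _} {_ , _} refl → refl }) (antidiagonal-unique k)

length-antidiagonal : ∀ k → length (antidiagonal k) ≡ suc k
length-antidiagonal zero    = refl
length-antidiagonal (suc k) = cong suc (trans (length-map (map₁ suc) (antidiagonal k)) (length-antidiagonal k))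

private
  splits : ℕ → List ((ℕ × ℕ) × Code)
  splits N = antidiagonal N ⊗ λ (l , k) → antidiagonal l ⊗ λ _ → antidiagonal k

  -- Here u and v drop by i and j, and the total is restored by raising a and d by e and e′ with e +
  -- e′ = i + j. These pairs (e , e′) are the i + j + 1 choices counted in β.
  lowerings : ℕ → ℕ → List (((ℕ × ℕ) × (ℕ × ℕ)) × (ℕ × ℕ))
  lowerings u v = (antidiagonal u ⊗ λ _ → antidiagonal v) ⊗ λ ((i , _) , (j , _)) → antidiagonal (i + j)

codes : ℕ → List Code
codes N = map proj₂ (splits N)

∈-codes⁺ : ∀ {t} → total t ≡ N → t ∈ codes N
∈-codes⁺ {t = (a , d) , (u , v)} t≡N = ∈-map⁺ proj₂ (∈-⊗⁺ (∈-antidiagonal⁺ {i = a + d} {u + v} t≡N)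
  (∈-⊗⁺ {f = λ _ → antidiagonal (u + v)} (∈-antidiagonal⁺ {i = a} refl) (∈-antidiagonal⁺ {i = u} refl)))

private
  ∈-splits⁻ : ∀ {l k a d u v} → ((l , k) , ((a , d) , (u , v))) ∈ splits N →
    l + k ≡ N × a + d ≡ l × u + v ≡ k
  ∈-splits⁻ {N} {l} {k} p with ∈-⊗⁻ (antidiagonal N) p
  ... | lk , q with ∈-⊗⁻ (antidiagonal l) q
  ... | ad , uv = ∈-antidiagonal⁻ N lk , ∈-antidiagonal⁻ l ad , ∈-antidiagonal⁻ k uv

∈-codes⁻ : ∀ {t} → t ∈ codes N → total t ≡ N
∈-codes⁻ {N} p with ∈-map⁻ proj₂ p
... | ((l , k) , _) , q , refl with ∈-splits⁻ {N} q
...   | lk , ad , uv = trans (cong₂ _+_ ad uv) lk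

codes-unique : ∀ N → Unique (codes N)
codes-unique N = map-unique injective (⊗-unique (antidiagonal-unique N) λ (l , k) →
  ⊗-unique (antidiagonal-unique l) λ _ → antidiagonal-unique k)
  where
  injective : ∀ {x y} → x ∈ splits N → y ∈ splits N → proj₂ x ≡ proj₂ y → x ≡ y
  injective p q refl with ∈-splits⁻ {N} p | ∈-splits⁻ {N} q
  -- The split (l , k) is recovered from the code as (a + d , u + v).
  ... | _ , refl , refl | _ , refl , refl = refl

private
  lower : ℕ → ℕ → ((ℕ × ℕ) × (ℕ × ℕ)) × (ℕ × ℕ) → Code
  lower a d (((i , i′) , (j , j′)) , (e , e′)) = (a + e , d + e′) , (i′ , j′)

below : Code → List Code
below ((a , d) , (u , v)) = map (lower a d) (lowerings u v)

private
  ∈-lowerings⁻ : ∀ {u v i i′ j j′ e e′} → (((i , i′) , (j , j′)) , (e , e′)) ∈ lowerings u v →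
    i + i′ ≡ u × j + j′ ≡ v × e + e′ ≡ i + j
  ∈-lowerings⁻ {u} {v} {i} {j = j} p with ∈-⊗⁻ (antidiagonal u ⊗ λ _ → antidiagonal v) p
  ... | q , ee with ∈-⊗⁻ (antidiagonal u) q
  ... | ii , jj = ∈-antidiagonal⁻ u ii , ∈-antidiagonal⁻ v jj , ∈-antidiagonal⁻ (i + j) ee

∈-below⁺ : ∀ {s t} → total s ≡ total t → s ≼ t → s ∈ below t
∈-below⁺ {_ , (i′ , j′)} {(a , d) , _} total≡ ((a≤ , d≤) , (u≤ , v≤))
  with m≤n⇒∃[o]m+o≡n a≤ | m≤n⇒∃[o]m+o≡n d≤ | m≤n⇒∃[o]m+o≡n u≤ | m≤n⇒∃[o]m+o≡n v≤
... | e , refl | e′ , refl | i , refl | j , refl = ∈-map⁺ (lower a d)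
  (∈-⊗⁺ (∈-⊗⁺ (∈-antidiagonal⁺ (+-comm i _)) (∈-antidiagonal⁺ (+-comm j _)))
        (∈-antidiagonal⁺ (balance a d i′ j′ total≡)))
  where
  balance : ∀ a d u v → (a + e + (d + e′)) + (u + v) ≡ (a + d) + (u + i + (v + j)) → e + e′ ≡ i + j
  balance a d u v p = +-cancelˡ-≡ (a + d + u + v) (e + e′) (i + j)
    (trans (eq₁ a d u v e e′) (trans p (eq₂ a d u v i j)))
    where
    eq₁ : ∀ a d u v e e′ → a + d + u + v + (e + e′) ≡ (a + e + (d + e′)) + (u + v)
    eq₁ = solve-∀
    eq₂ : ∀ a d u v i j → (a + d) + (u + i + (v + j)) ≡ a + d + u + v + (i + j)
    eq₂ = solve-∀

∈-below⁻ : ∀ {s} t → s ∈ below t → total s ≡ total t × s ≼ t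
∈-below⁻ ((a , d) , (u , v)) p with ∈-map⁻ _ p
... | (((i , i′) , (j , j′)) , (e , e′)) , q , refl with ∈-lowerings⁻ {u} {v} q
... | refl , refl , ee = balance ,
  ((m≤m+n a e , m≤m+n d e′) , (m≤n+m i′ i , m≤n+m j′ j))
  where
  open ≡-Reasoning
  eq₁ : ∀ a d i′ j′ e e′ → (a + e + (d + e′)) + (i′ + j′) ≡ a + d + i′ + j′ + (e + e′)
  eq₁ = solve-∀
  eq₂ : ∀ a d i i′ j j′ → a + d + i′ + j′ + (i + j) ≡ (a + d) + ((i + i′) + (j + j′))
  eq₂ = solve-∀
  balance : (a + e + (d + e′)) + (i′ + j′) ≡ (a + d) + ((i + i′) + (j + j′))
  balance = trans (eq₁ a d i′ j′ e e′) (trans (cong (a + d + i′ + j′ +_) ee) (eq₂ a d i i′ j j′))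

below-unique : ∀ t → Unique (below t)
below-unique ((a , d) , (u , v)) = map-unique injective
  (⊗-unique (⊗-unique (antidiagonal-unique u) λ _ → antidiagonal-unique v)
            λ ((i , _) , (j , _)) → antidiagonal-unique (i + j))
  where
  injective : ∀ {x y} → x ∈ lowerings u v → y ∈ lowerings u v → lower a d x ≡ lower a d y → x ≡ y
  injective {((i , i′) , (j , j′)) , (e , e′)} {((k , k′) , (l , l′)) , (f , f′)} p q eq
    with ∈-lowerings⁻ {u} {v} p | ∈-lowerings⁻ {u} {v} q
  ... | refl , refl , _ | kk , ll , _
    with ,-injectiveʳ eq | +-cancelˡ-≡ a e f (cong (proj₁ ∘ proj₁) eq) | +-cancelˡ-≡ d e′ f′ (cong (proj₂ ∘ proj₁) eq)
  ... | refl | refl | refl with +-cancelʳ-≡ i′ k i kk | +-cancelʳ-≡ j′ l j ll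
  ... | refl | refl = refl

-- Transfer of sums from permutations to codes

∈𝔅⇒bigrassmannian : ∀ (σ : Permutation′ n) → σ ∈ 𝔅 n → IsBigrassmannian σ
∈𝔅⇒bigrassmannian {n} σ σ∈ = proj₂ (∈-filter⁻ {P = IsBigrassmannian} isBigrassmannian? {v = σ} {xs = 𝔖 n} σ∈)

-- The list entry found is only pointwise equal to τ, but it has the same code, and the code is all
-- that later counts use.
𝔅-complete : ∀ (τ : Permutation′ n) {t} → Represents τ t → ∃ λ σ → σ ∈ 𝔅 n × Represents σ t
𝔅-complete {n} τ {t} Rτ with find (𝔖-complete n τ)
... | σ , σ∈ , τ≈σ = σ , ∈-filter⁺ {P = IsBigrassmannian} isBigrassmannian? {x = σ} {xs = 𝔖 n} σ∈ (represents⇒bigrassmannian {σ = σ} Rσ) , Rσ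
  where
  Rσ : Represents σ t
  Rσ = represents (Represents.total≡ Rτ)
    (λ k → trans (sym (≈⇒hat-≗ {σ = τ} {σ} τ≈σ k)) (Represents.hat≗ Rτ k))

dual : Code → Code
dual = swap

total-dual : ∀ t → total (dual t) ≡ total t
total-dual ((a , d) , (u , v)) = +-comm (u + v) (a + d)

-- Everything is stated for Represents σ (θ t), where θ is the identity for β and duality for α.
module _ (θ : Code → Code) (θ-involutive : ∀ t → θ (θ t) ≡ t) (total-θ : ∀ t → total (θ t) ≡ total t) where

  private
    ∈𝔅⇒represents : ∀ (σ : Permutation′ n) → σ ∈ 𝔅 n → ∃ λ t → 2 + total t ≡ n × Represents σ (θ t)
    ∈𝔅⇒represents σ σ∈ =
      let t , R = bigrassmannian⇒represents {σ = σ} (∈𝔅⇒bigrassmannian σ σ∈) in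
      θ t , trans (cong (2 +_) (total-θ t)) (Represents.total≡ R) ,
      subst (Represents σ) (sym (θ-involutive t)) R

    represented-in-𝔅 : ∀ t → 2 + total t ≡ n → ∃ λ (σ : Permutation′ n) → σ ∈ 𝔅 n × Represents σ (θ t)
    represented-in-𝔅 t t≡n =
      let τ , Rτ = represented (θ t) (trans (cong (2 +_) (total-θ t)) t≡n) in 𝔅-complete τ Rτ

    θ-injective : ∀ {σ : Permutation′ n} {s t} → Represents σ (θ s) → Represents σ (θ t) → s ≡ t
    θ-injective {s = s} {t} Rs Rt =
      trans (sym (θ-involutive s)) (trans (cong θ (represents-injective Rs Rt)) (θ-involutive t))

    Apart : Permutation′ n → Permutation′ n → Set
    Apart π σ = ∀ {t} → Represents π (θ t) → ¬ Represents σ (θ t)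

    𝔅-apart : AllPairs Apart (𝔅 n)
    𝔅-apart {n} = AllPairs.filter⁺ isBigrassmannian? (mapAllPairs (𝔖-unique n))
      where
      mapAllPairs : ∀ {xs} → AllPairs (λ π σ → ¬ π ≈ σ) xs → AllPairs Apart xs
      mapAllPairs []         = []
      mapAllPairs (x# ∷ xs#) =
        All.map (λ {σ} π≉σ {t} Rπ Rσ → π≉σ (represents-functional {t = θ t} Rπ Rσ)) x# ∷ mapAllPairs xs#

  sumOver-𝔅 : ∀ {N} → 2 + N ≡ n → ∀ {f : Permutation′ n → ℕ} {g : Code → ℕ} →
    (∀ {σ t} → Represents σ (θ t) → f σ ≡ g t) → sumOver (𝔅 n) f ≡ sumOver (codes N) g
  sumOver-𝔅 {n} {N} 2+N≡n fg = sumOver-matching {R = λ σ t → Represents σ (θ t)} θ-injective 𝔅-apart (codes-unique N)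
    (λ {σ} σ∈ → let t , t≡n , R = ∈𝔅⇒represents σ σ∈ in t , ∈-codes⁺ (suc-injective (suc-injective (trans t≡n (sym 2+N≡n)))) , R)
    (λ t∈ → represented-in-𝔅 _ (trans (cong (2 +_) (∈-codes⁻ t∈)) 2+N≡n)) fg

  length-filter-𝔅 : ∀ {P : Permutation′ n → Set} (P? : Decidable P) t → 2 + total t ≡ n →
    (∀ {σ s} → Represents σ (θ s) → P σ → s ≼ t) → (∀ {σ s} → Represents σ (θ s) → s ≼ t → P σ) →
    length (filter P? (𝔅 n)) ≡ length (below t)
  length-filter-𝔅 {n} {P} P? t t≡n to from = begin
    length (filter P? (𝔅 n))            ≡⟨ length≡sumOver (filter P? (𝔅 n)) ⟩
    sumOver (filter P? (𝔅 n)) (const 1) ≡⟨ sumOver-matching {R = λ σ t → Represents σ (θ t)} θ-injective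
      {xs = filter P? (𝔅 n)} {ys = below t} {f = const 1} {g = const 1} (AllPairs.filter⁺ P? 𝔅-apart) (below-unique t) forth back (λ _ → refl) ⟩
    sumOver (below t) (const 1)               ≡⟨ length≡sumOver (below t) ⟨
    length (below t)                          ∎
    where
    open ≡-Reasoning
    forth : ∀ {σ} → σ ∈ filter P? (𝔅 n) → ∃ λ s → s ∈ below t × Represents σ (θ s)
    forth {σ} σ∈ =
      let σ∈𝔅 , Pσ = ∈-filter⁻ {P = P} P? {v = σ} {xs = 𝔅 n} σ∈
          s , s≡n , R = ∈𝔅⇒represents σ σ∈𝔅
      in s , ∈-below⁺ (suc-injective (suc-injective (trans s≡n (sym t≡n)))) (to R Pσ) , R
    back : ∀ {s} → s ∈ below t → ∃ λ σ → σ ∈ filter P? (𝔅 n) × Represents σ (θ s)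
    back {s} s∈ =
      let s≡t , s≼t = ∈-below⁻ t s∈
          σ , σ∈𝔅 , R = represented-in-𝔅 s (trans (cong (2 +_) s≡t) t≡n)
      in σ , ∈-filter⁺ {P = P} P? {x = σ} {xs = 𝔅 n} σ∈𝔅 (from R s≼t) , R

β≡length-below : ∀ {ω : Permutation′ n} {t} → Represents ω t → β ω ≡ length (below t)
β≡length-below {ω = ω} {t} Rω = length-filter-𝔅 id (λ _ → refl) (λ _ → refl) (_≤ᴮ? ω) t
  (Represents.total≡ Rω) (λ R → ≤ᴮ⇒≼ R Rω) (λ R → ≼⇒≤ᴮ R Rω)

-- For τ with code dual s, ω ≤ᴮ τ means dual t ≼ dual s, which is s ≼ t with its two halves swapped.
-- So `below` also counts what lies above.
α≡length-below : ∀ {ω : Permutation′ n} {t} → Represents ω (dual t) → α ω ≡ length (below t)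
α≡length-below {ω = ω} {t} Rω = length-filter-𝔅 dual (λ _ → refl) total-dual (ω ≤ᴮ?_) t
  (trans (cong (2 +_) (sym (total-dual t))) (Represents.total≡ Rω))
  (λ R p → swap (≤ᴮ⇒≼ Rω R p)) (λ R p → ≼⇒≤ᴮ Rω R (swap p))

-- Moments

-- Closed forms are proved with an offset t in the first coordinate, because the tail of the
-- antidiagonal of k + 1 is the antidiagonal of k with its first coordinates raised by one.
sumOver-antidiagonal : ∀ (F : ℕ → ℕ × ℕ → ℕ) (P : ℕ → ℕ → ℕ) →
  (∀ t i j → F t (suc i , j) ≡ F (suc t) (i , j)) →
  (∀ t → F t (0 , 0) ≡ P 0 t) → (∀ k t → F t (0 , suc k) + P k (suc t) ≡ P (suc k) t) →
  ∀ k t → sumOver (antidiagonal k) (F t) ≡ P k t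
sumOver-antidiagonal F P shift base step zero    t = trans (+-identityʳ _) (base t)
sumOver-antidiagonal F P shift base step (suc k) t = trans (cong (F t (0 , suc k) +_) (begin
  sumOver (map (map₁ suc) (antidiagonal k)) (F t) ≡⟨ sumOver-map (F t) (map₁ suc) (antidiagonal k) ⟩
  sumOver (antidiagonal k) (F t ∘ map₁ suc)       ≡⟨ sumOver-cong (antidiagonal k) (λ (i , j) → shift t i j) ⟩
  sumOver (antidiagonal k) (F (suc t))            ≡⟨ sumOver-antidiagonal F P shift base step k (suc t) ⟩
  P k (suc t)                                     ∎)) (step k t)
  where open ≡-Reasoning

below-size : ℕ × ℕ → ℕ
below-size (u , v) = sumOver (antidiagonal u) λ (i , _) → sumOver (antidiagonal v) λ (j , _) → suc (i + j)

length-below : ∀ t → length (below t) ≡ below-size (proj₂ t)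
length-below ((a , d) , (u , v)) = begin
  length (below ((a , d) , (u , v)))   ≡⟨ length-map _ (uv ⊗ ee) ⟩
  length (uv ⊗ ee)                     ≡⟨ length≡sumOver (uv ⊗ ee) ⟩
  sumOver (uv ⊗ ee) (const 1)          ≡⟨ sumOver-⊗ uv (const 1) ⟩
  sumOver uv (λ p → sumOver (ee p) (const 1)) ≡⟨ sumOver-⊗ (antidiagonal u) _ ⟩
  _                                    ≡⟨ sumOver-cong (antidiagonal u) (λ (i , _) → sumOver-cong (antidiagonal v) λ (j , _) →
                                            trans (sym (length≡sumOver (antidiagonal (i + j)))) (length-antidiagonal (i + j))) ⟩
  below-size (u , v)                   ∎
  where
  open ≡-Reasoning
  uv = antidiagonal u ⊗ λ _ → antidiagonal v
  ee : (ℕ × ℕ) × (ℕ × ℕ) → List (ℕ × ℕ)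
  ee ((i , _) , (j , _)) = antidiagonal (i + j)

2*below-size : ∀ u v → 2 * below-size (u , v) ≡ suc u * suc v * (u + v + 2)
2*below-size u v = begin
  2 * below-size (u , v)  ≡⟨ sumOver-*ˡ 2 _ (antidiagonal u) ⟩
  _                       ≡⟨ sumOver-cong (antidiagonal u) (λ (i , _) →
                               trans (sumOver-*ˡ 2 _ (antidiagonal v)) (inner v (suc i))) ⟩
  -- The summand has suc i, that is 1 + i, so the offset is 1 here.
  sumOver (antidiagonal u) (λ (i , _) → suc v * (2 * suc i + v)) ≡⟨ outer u 1 ⟩
  suc u * suc v * (2 * 1 + u + v) ≡⟨ eq u v ⟩
  suc u * suc v * (u + v + 2)     ∎
  where
  open ≡-Reasoning
  inner : ∀ v c → sumOver (antidiagonal v) (λ (j , _) → 2 * (c + j)) ≡ suc v * (2 * c + v)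
  inner = sumOver-antidiagonal (λ c (j , _) → 2 * (c + j)) (λ v c → suc v * (2 * c + v))
    (λ c j _ → cong (2 *_) (+-suc c j)) base step
    where
    base : ∀ c → 2 * (c + 0) ≡ 1 * (2 * c + 0)
    base = solve-∀
    step : ∀ v c → 2 * (c + 0) + suc v * (2 * suc c + v) ≡ suc (suc v) * (2 * c + suc v)
    step = solve-∀
  outer : ∀ u t → sumOver (antidiagonal u) (λ (i , _) → suc v * (2 * (t + i) + v)) ≡ suc u * suc v * (2 * t + u + v)
  outer = sumOver-antidiagonal (λ t (i , _) → suc v * (2 * (t + i) + v)) (λ u t → suc u * suc v * (2 * t + u + v))
    (λ t i _ → cong (λ x → suc v * (2 * x + v)) (+-suc t i)) (base v) (step v)
    where
    base : ∀ v t → suc v * (2 * (t + 0) + v) ≡ 1 * suc v * (2 * t + 0 + v)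
    base = solve-∀
    step : ∀ v u t → suc v * (2 * (t + 0) + v) + suc u * suc v * (2 * suc t + u + v) ≡ suc (suc u) * suc v * (2 * t + suc u + v)
    step = solve-∀
  eq : ∀ u v → suc u * suc v * (2 * 1 + u + v) ≡ suc u * suc v * (u + v + 2)
  eq = solve-∀

-- On the antidiagonal u + v + 2 is the constant k + 2, and the sum of (u + 1)(v + 1) is the
-- binomial coefficient k + 3 over 3. Their denominators 2 and 6 make 12.
12*sum-below-size : ∀ k → 12 * sumOver (antidiagonal k) below-size ≡ (k + 2) * ((k + 1) * (k + 2) * (k + 3))
12*sum-below-size k = begin
  12 * sumOver (antidiagonal k) below-size              ≡⟨ sumOver-*ˡ 12 below-size (antidiagonal k) ⟩
  sumOver (antidiagonal k) (λ p → 12 * below-size p)    ≡⟨ sumOver-cong (antidiagonal k) (λ (u , v) →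
    trans (eq₁ (below-size (u , v))) (trans (cong (6 *_) (2*below-size u v)) (eq₂ u v))) ⟩
  sumOver (antidiagonal k) (F 0)                        ≡⟨ sumOver-antidiagonal F P shift base step k 0 ⟩
  P k 0                                                 ≡⟨ eq₃ k ⟩
  (k + 2) * ((k + 1) * (k + 2) * (k + 3))               ∎
  where
  open ≡-Reasoning
  F : ℕ → ℕ × ℕ → ℕ
  F t (u , v) = 6 * (suc (u + t) * suc v * (u + v + t + 2))
  P : ℕ → ℕ → ℕ
  -- The offset adds 6 t times the sum of v + 1, which is 3 t (k + 1)(k + 2).
  P k t = (k + t + 2) * ((k + 1) * (k + 2) * (k + 3) + 3 * t * (k + 1) * (k + 2))
  eq₁ : ∀ b → 12 * b ≡ 6 * (2 * b)
  eq₁ = solve-∀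
  eq₂ : ∀ u v → 6 * (suc u * suc v * (u + v + 2)) ≡ 6 * (suc (u + 0) * suc v * (u + v + 0 + 2))
  eq₂ = solve-∀
  eq₃ : ∀ k → (k + 0 + 2) * ((k + 1) * (k + 2) * (k + 3) + 0) ≡ (k + 2) * ((k + 1) * (k + 2) * (k + 3))
  eq₃ = solve-∀
  shift : ∀ t u v → 6 * (suc (suc u + t) * suc v * (suc u + v + t + 2)) ≡ 6 * (suc (u + suc t) * suc v * (u + v + suc t + 2))
  shift = solve-∀
  base : ∀ t → 6 * (suc t * 1 * (t + 2)) ≡ (t + 2) * (6 + 3 * t * 1 * 2)
  base = solve-∀
  step : ∀ k t → 6 * (suc t * suc (suc k) * (suc k + t + 2)) +
    (k + suc t + 2) * ((k + 1) * (k + 2) * (k + 3) + 3 * suc t * (k + 1) * (k + 2)) ≡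
    (suc k + t + 2) * ((suc k + 1) * (suc k + 2) * (suc k + 3) + 3 * t * (suc k + 1) * (suc k + 2))
  step = solve-∀

120*sum-below-size² : ∀ k → 120 * sumOver (antidiagonal k) (λ p → below-size p * below-size p) ≡
  (k + 2) * (k + 2) * ((k + 1) * (k + 2) * (k + 3) * (k * k + 4 * k + 5))
120*sum-below-size² k = begin
  120 * sumOver (antidiagonal k) (λ p → below-size p * below-size p)
                                    ≡⟨ sumOver-*ˡ 120 _ (antidiagonal k) ⟩
  _                                 ≡⟨ sumOver-cong (antidiagonal k) (λ (u , v) →
    trans (eq₁ (below-size (u , v))) (trans (cong (λ x → 30 * (x * x)) (2*below-size u v)) (eq₂ u v))) ⟩
  sumOver (antidiagonal k) (F 0)    ≡⟨ sumOver-antidiagonal F P shift base step k 0 ⟩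
  P k 0                             ≡⟨ eq₃ k ⟩
  _                                 ∎
  where
  open ≡-Reasoning
  F : ℕ → ℕ × ℕ → ℕ
  F t (u , v) = 30 * (suc (u + t) * suc v * (u + v + t + 2) * (suc (u + t) * suc v * (u + v + t + 2)))
  P : ℕ → ℕ → ℕ
  -- After the constant factor (k + t + 2)², the coefficients of 1, t and t² are the sums over u + v
  -- = k of 30 (u + 1)²(v + 1)², 60 (u + 1)(v + 1)² and 30 (v + 1)².
  P k t = (k + t + 2) * (k + t + 2) * ((k + 1) * (k + 2) * (k + 3) * (k * k + 4 * k + 5)
    + 5 * t * ((k + 2) * (k + 2) * (k + 1) * (k + 3)) + 5 * t * t * ((k + 1) * (k + 2) * (2 * k + 3)))
  eq₁ : ∀ b → 120 * (b * b) ≡ 30 * ((2 * b) * (2 * b))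
  eq₁ = solve-∀
  eq₂ : ∀ u v → 30 * (suc u * suc v * (u + v + 2) * (suc u * suc v * (u + v + 2))) ≡
    30 * (suc (u + 0) * suc v * (u + v + 0 + 2) * (suc (u + 0) * suc v * (u + v + 0 + 2)))
  eq₂ u v rewrite +-identityʳ u | +-identityʳ (u + v) = refl
  eq₃ : ∀ k → (k + 0 + 2) * (k + 0 + 2) * ((k + 1) * (k + 2) * (k + 3) * (k * k + 4 * k + 5) + 0 + 0) ≡
    (k + 2) * (k + 2) * ((k + 1) * (k + 2) * (k + 3) * (k * k + 4 * k + 5))
  eq₃ = solve-∀
  shift : ∀ t u v → F t (suc u , v) ≡ F (suc t) (u , v)
  shift t u v rewrite +-suc u t | +-suc (u + v) t = refl
  base : ∀ t → 30 * (suc t * 1 * (t + 2) * (suc t * 1 * (t + 2))) ≡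
    (t + 2) * (t + 2) * (30 + 5 * t * 12 + 5 * t * t * 6)
  base = solve-∀
  step : ∀ k t → 30 * (suc t * suc (suc k) * (suc k + t + 2) * (suc t * suc (suc k) * (suc k + t + 2))) +
    (k + suc t + 2) * (k + suc t + 2) * ((k + 1) * (k + 2) * (k + 3) * (k * k + 4 * k + 5)
    + 5 * suc t * ((k + 2) * (k + 2) * (k + 1) * (k + 3)) + 5 * suc t * suc t * ((k + 1) * (k + 2) * (2 * k + 3))) ≡
    (suc k + t + 2) * (suc k + t + 2) * ((suc k + 1) * (suc k + 2) * (suc k + 3) * (suc k * suc k + 4 * suc k + 5)
    + 5 * t * ((suc k + 2) * (suc k + 2) * (suc k + 1) * (suc k + 3)) + 5 * t * t * ((suc k + 1) * (suc k + 2) * (2 * suc k + 3)))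
  step = solve-∀

-- Each (u , v) occurs once for every (a , d) with a + d = l, that is suc l times.
sumOver-codes : ∀ N (g : ℕ × ℕ → ℕ) → sumOver (codes N) (g ∘ proj₂) ≡
                sumOver (antidiagonal N) (λ (l , k) → suc l * sumOver (antidiagonal k) g)
sumOver-codes N g = begin
  sumOver (codes N) (g ∘ proj₂)              ≡⟨ sumOver-map (g ∘ proj₂) proj₂ (antidiagonal N ⊗ fibre) ⟩
  sumOver (antidiagonal N ⊗ fibre) (g ∘ proj₂ ∘ proj₂) ≡⟨ sumOver-⊗ (antidiagonal N) _ ⟩
  _ ≡⟨ sumOver-cong (antidiagonal N) (λ (l , k) → trans (sumOver-⊗ (antidiagonal l) (g ∘ proj₂))
         (trans (sumOver-const _ (antidiagonal l)) (cong (_* sumOver (antidiagonal k) g) (length-antidiagonal l)))) ⟩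
  _ ∎
  where
  open ≡-Reasoning
  fibre : ℕ × ℕ → List Code
  fibre (l , k) = antidiagonal l ⊗ λ _ → antidiagonal k

-- S and H are m times the sums of (l + 1) h(k) over l + k = N and of h(k) over k ≤ N.
-- The factors of m * d stay apart: comparing 8640 * x with 72 * (120 * x) would unfold 8640 summands.
m*d*sumOver-codes : ∀ m d (g : ℕ × ℕ → ℕ) (h S H : ℕ → ℕ) →
  (∀ k → d * sumOver (antidiagonal k) g ≡ h k) →
  m * h 0 ≡ S 0 → m * h 0 ≡ H 0 →
  (∀ k t → suc t * (m * h (suc k)) + (S k + suc t * H k) ≡ S (suc k) + t * H (suc k)) →
  ∀ N → m * d * sumOver (codes N) (g ∘ proj₂) ≡ S N
m*d*sumOver-codes m d g h S H dh baseS baseH step N = begin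
  m * d * sumOver (codes N) (g ∘ proj₂)   ≡⟨ cong (m * d *_) (sumOver-codes N g) ⟩
  m * d * sumOver (antidiagonal N) (λ (l , k) → suc l * sumOver (antidiagonal k) g)
    ≡⟨ sumOver-*ˡ (m * d) _ (antidiagonal N) ⟩
  _ ≡⟨ sumOver-cong (antidiagonal N) (λ (l , k) →
         trans (eq m d (suc l) _) (cong₂ (λ x y → suc x * (m * y)) (sym (+-identityʳ l)) (dh k))) ⟩
  sumOver (antidiagonal N) (λ (l , k) → suc (l + 0) * (m * h k))
    ≡⟨ sumOver-antidiagonal (λ t (l , k) → suc (l + t) * (m * h k)) (λ N t → S N + t * H N)
         (λ t l k → cong (λ x → suc x * (m * h k)) (sym (+-suc l t)))
         (λ t → cong₂ (λ x y → x + t * y) baseS baseH) step N 0 ⟩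
  S N + 0                             ≡⟨ +-identityʳ (S N) ⟩
  S N                                 ∎
  where
  open ≡-Reasoning
  eq : ∀ m d l s → m * d * (l * s) ≡ l * (m * (d * s))
  eq = solve-∀

6*length-codes : ∀ N → 6 * length (codes N) ≡ (N + 1) * (N + 2) * (N + 3)
6*length-codes N = trans (cong (6 *_) (length≡sumOver (codes N)))
  (m*d*sumOver-codes 6 1 (const 1) (λ k → k + 1) (λ N → (N + 1) * (N + 2) * (N + 3))
    (λ N → 3 * (N + 1) * (N + 2))
    (λ k → trans (*-identityˡ _) (trans (sym (length≡sumOver (antidiagonal k)))
                                        (trans (length-antidiagonal k) (+-comm 1 k)))) refl refl step N)
  where
  step : ∀ k t → suc t * (6 * (suc k + 1)) + ((k + 1) * (k + 2) * (k + 3) + suc t * (3 * (k + 1) * (k + 2))) ≡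
    (suc k + 1) * (suc k + 2) * (suc k + 3) + t * (3 * (suc k + 1) * (suc k + 2))
  step = solve-∀

360*sum-codes : ∀ N → 30 * 12 * sumOver (codes N) (below-size ∘ proj₂) ≡
  (N + 1) * (N + 2) * (N + 3) * (N + 3) * (N + 4) * (N + 5)
360*sum-codes = m*d*sumOver-codes 30 12 below-size
  (λ k → (k + 2) * ((k + 1) * (k + 2) * (k + 3)))
  (λ N → (N + 1) * (N + 2) * (N + 3) * (N + 3) * (N + 4) * (N + 5))
  (λ N → 3 * (N + 1) * (N + 2) * (N + 3) * (N + 4) * (2 * N + 5))
  12*sum-below-size refl refl step
  where
  step : ∀ k t → suc t * (30 * ((suc k + 2) * ((suc k + 1) * (suc k + 2) * (suc k + 3)))) +
    ((k + 1) * (k + 2) * (k + 3) * (k + 3) * (k + 4) * (k + 5) +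
      suc t * (3 * (k + 1) * (k + 2) * (k + 3) * (k + 4) * (2 * k + 5))) ≡
    (suc k + 1) * (suc k + 2) * (suc k + 3) * (suc k + 3) * (suc k + 4) * (suc k + 5) +
      t * (3 * (suc k + 1) * (suc k + 2) * (suc k + 3) * (suc k + 4) * (2 * suc k + 5))
  step = solve-∀

8640*sum²-codes : ∀ N → 72 * 120 * sumOver (codes N) ((λ p → below-size p * below-size p) ∘ proj₂) ≡
  (N + 1) * (N + 2) * (N + 2) * (N + 3) * (N + 3) * (N + 3) * (N + 4) * (N + 4) * (N + 5)
8640*sum²-codes = m*d*sumOver-codes 72 120 (λ p → below-size p * below-size p)
  (λ k → (k + 2) * (k + 2) * ((k + 1) * (k + 2) * (k + 3) * (k * k + 4 * k + 5)))
  (λ N → (N + 1) * (N + 2) * (N + 2) * (N + 3) * (N + 3) * (N + 3) * (N + 4) * (N + 4) * (N + 5))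
  (λ N → 3 * (N + 1) * (N + 2) * (N + 2) * (N + 3) * (N + 3) * (N + 4) * (3 * N * N + 15 * N + 20))
  120*sum-below-size² refl refl step
  where
  step : ∀ k t → suc t * (72 * ((suc k + 2) * (suc k + 2) * ((suc k + 1) * (suc k + 2) * (suc k + 3) * (suc k * suc k + 4 * suc k + 5)))) +
    ((k + 1) * (k + 2) * (k + 2) * (k + 3) * (k + 3) * (k + 3) * (k + 4) * (k + 4) * (k + 5) +
      suc t * (3 * (k + 1) * (k + 2) * (k + 2) * (k + 3) * (k + 3) * (k + 4) * (3 * k * k + 15 * k + 20))) ≡
    (suc k + 1) * (suc k + 2) * (suc k + 2) * (suc k + 3) * (suc k + 3) * (suc k + 3) * (suc k + 4) * (suc k + 4) * (suc k + 5) +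
      t * (3 * (suc k + 1) * (suc k + 2) * (suc k + 2) * (suc k + 3) * (suc k + 3) * (suc k + 4) * (3 * suc k * suc k + 15 * suc k + 20))
  step = solve-∀

-- Opened only here, since it would clash with left sections of addition on ℕ.
open import Data.Integer.Base using (+_)

-- Expectation and variance

toℚᵘ-/ : ∀ i d → toℚᵘ (i / suc d) ℚᵘ.≃ mkℚᵘ i d
toℚᵘ-/ i d = ℚ.toℚᵘ-fromℚᵘ (mkℚᵘ i d)

fromℕ-+ : ∀ a b → fromℕ (a + b) ≡ fromℕ a ℚ.+ fromℕ b
fromℕ-+ a b = ℚ.toℚᵘ-injective (begin
  toℚᵘ (fromℕ (a + b))                  ≈⟨ toℚᵘ-/ (+ (a + b)) 0 ⟩
  mkℚᵘ (+ (a + b)) 0                    ≈⟨ *≡* (cong (ℤ._* + 1) (cong₂ ℤ._+_ (sym (ℤ.*-identityʳ (+ a))) (sym (ℤ.*-identityʳ (+ b))))) ⟩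
  mkℚᵘ (+ a) 0 ℚᵘ.+ mkℚᵘ (+ b) 0        ≈⟨ ℚᵘ.+-cong (toℚᵘ-/ (+ a) 0) (toℚᵘ-/ (+ b) 0) ⟨
  toℚᵘ (fromℕ a) ℚᵘ.+ toℚᵘ (fromℕ b)    ≈⟨ ℚ.toℚᵘ-homo-+ (fromℕ a) (fromℕ b) ⟨
  toℚᵘ (fromℕ a ℚ.+ fromℕ b)            ∎)
  where open ℚᵘ.≃-Reasoning

fromℕ-* : ∀ a b → fromℕ (a * b) ≡ fromℕ a ℚ.* fromℕ b
fromℕ-* a b = ℚ.toℚᵘ-injective (begin
  toℚᵘ (fromℕ (a * b))                  ≈⟨ toℚᵘ-/ (+ (a * b)) 0 ⟩
  mkℚᵘ (+ (a * b)) 0                    ≈⟨ *≡* (cong (ℤ._* + 1) (ℤ.pos-* a b)) ⟩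
  mkℚᵘ (+ a) 0 ℚᵘ.* mkℚᵘ (+ b) 0        ≈⟨ ℚᵘ.*-cong (toℚᵘ-/ (+ a) 0) (toℚᵘ-/ (+ b) 0) ⟨
  toℚᵘ (fromℕ a) ℚᵘ.* toℚᵘ (fromℕ b)    ≈⟨ ℚ.toℚᵘ-homo-* (fromℕ a) (fromℕ b) ⟨
  toℚᵘ (fromℕ a ℚ.* fromℕ b)            ∎)
  where open ℚᵘ.≃-Reasoning

-- The only fact used about a quotient. Together with `*-fromℕ-cancelʳ` it turns equalities of
-- fractions into equalities in ℕ, so normalised fractions are never inspected.
/-*-fromℕ : ∀ p d .{{_ : ℕ.NonZero d}} → (+ p / d) ℚ.* fromℕ d ≡ fromℕ p
/-*-fromℕ p (suc d) = ℚ.toℚᵘ-injective (begin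
  toℚᵘ ((+ p / suc d) ℚ.* fromℕ (suc d))          ≈⟨ ℚ.toℚᵘ-homo-* (+ p / suc d) (fromℕ (suc d)) ⟩
  toℚᵘ (+ p / suc d) ℚᵘ.* toℚᵘ (fromℕ (suc d))    ≈⟨ ℚᵘ.*-cong (toℚᵘ-/ (+ p) d) (toℚᵘ-/ (+ suc d) 0) ⟩
  mkℚᵘ (+ p) d ℚᵘ.* mkℚᵘ (+ suc d) 0              ≈⟨ *≡* (trans (ℤ.*-identityʳ _) (cong (λ x → + p ℤ.* + suc x) (sym (ℕ.*-identityʳ d)))) ⟩
  mkℚᵘ (+ p) 0                                    ≈⟨ toℚᵘ-/ (+ p) 0 ⟨
  toℚᵘ (fromℕ p)                                  ∎)
  where open ℚᵘ.≃-Reasoning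

*-fromℕ-cancelʳ : ∀ d .{{_ : ℕ.NonZero d}} {x y} → x ℚ.* fromℕ d ≡ y ℚ.* fromℕ d → x ≡ y
*-fromℕ-cancelʳ d {x} {y} eq = trans (expand x) (trans (cong (ℚ._* (+ 1 / d)) eq) (sym (expand y)))
  where
  expand : ∀ z → z ≡ z ℚ.* fromℕ d ℚ.* (+ 1 / d)
  expand z = begin
    z                                 ≡⟨ ℚ.*-identityʳ z ⟨
    z ℚ.* fromℕ 1                     ≡⟨ cong (z ℚ.*_) (/-*-fromℕ 1 d) ⟨
    z ℚ.* ((+ 1 / d) ℚ.* fromℕ d)     ≡⟨ solve 3 (λ z i d → z :* (i :* d) := z :* d :* i) refl z (+ 1 / d) (fromℕ d) ⟩
    z ℚ.* fromℕ d ℚ.* (+ 1 / d)       ∎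
    where open ≡-Reasoning

/-cross : ∀ p d q e .{{_ : ℕ.NonZero d}} .{{_ : ℕ.NonZero e}} → p * e ≡ q * d → + p / d ≡ + q / e
/-cross p d q e eq = *-fromℕ-cancelʳ d (*-fromℕ-cancelʳ e (begin
  (+ p / d) ℚ.* fromℕ d ℚ.* fromℕ e   ≡⟨ cong (ℚ._* fromℕ e) (/-*-fromℕ p d) ⟩
  fromℕ p ℚ.* fromℕ e                 ≡⟨ fromℕ-* p e ⟨
  fromℕ (p * e)                       ≡⟨ cong fromℕ eq ⟩
  fromℕ (q * d)                       ≡⟨ fromℕ-* q d ⟩
  fromℕ q ℚ.* fromℕ d                 ≡⟨ cong (ℚ._* fromℕ d) (/-*-fromℕ q e) ⟨
  (+ q / e) ℚ.* fromℕ e ℚ.* fromℕ d   ≡⟨ solve 3 (λ x e d → x :* e :* d := x :* d :* e) refl (+ q / e) (fromℕ e) (fromℕ d) ⟩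
  (+ q / e) ℚ.* fromℕ d ℚ.* fromℕ e   ∎))
  where open ≡-Reasoning

sumℚ : List A → (A → ℚ) → ℚ
sumℚ xs X = foldr ℚ._+_ 0ℚ (map X xs)

𝔼-*-length : ∀ (xs : List A) X → 𝔼 xs X ℚ.* fromℕ (length xs) ≡ sumℚ xs X
𝔼-*-length []       X = refl
𝔼-*-length (x ∷ xs) X = begin
  s ℚ.* (+ 1 / m) ℚ.* fromℕ m     ≡⟨ ℚ.*-assoc s (+ 1 / m) (fromℕ m) ⟩
  s ℚ.* ((+ 1 / m) ℚ.* fromℕ m)   ≡⟨ cong (s ℚ.*_) (/-*-fromℕ 1 m) ⟩
  s ℚ.* fromℕ 1                   ≡⟨ ℚ.*-identityʳ s ⟩
  s                               ∎
  where
  open ≡-Reasoning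
  m = suc (length xs)
  s = sumℚ (x ∷ xs) X

sumℚ-fromℕ : ∀ (xs : List A) X → sumℚ xs (fromℕ ∘ X) ≡ fromℕ (sumOver xs X)
sumℚ-fromℕ []       X = refl
sumℚ-fromℕ (x ∷ xs) X = trans (cong (fromℕ (X x) ℚ.+_) (sumℚ-fromℕ xs X)) (sym (fromℕ-+ (X x) (sumOver xs X)))

-- The expanded square, with the mixed term moved to the left. μ is arbitrary because the mean of
-- the tail of a list differs from that of the list.
sumℚ-deviation : ∀ (xs : List A) (X : A → ℕ) μ →
  sumℚ xs (λ x → (fromℕ (X x) ℚ.- μ) ℚ.* (fromℕ (X x) ℚ.- μ)) ℚ.+ (μ ℚ.+ μ) ℚ.* fromℕ (sumOver xs X)
    ≡ fromℕ (sumOver xs (λ x → X x * X x)) ℚ.+ μ ℚ.* μ ℚ.* fromℕ (length xs)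
sumℚ-deviation []       X μ = solve 1 (λ μ → con 0ℚ :+ (μ :+ μ) :* con 0ℚ := con 0ℚ :+ μ :* μ :* con 0ℚ) refl μ
sumℚ-deviation (x ∷ xs) X μ = begin
  (a ℚ.- μ) ℚ.* (a ℚ.- μ) ℚ.+ d ℚ.+ (μ ℚ.+ μ) ℚ.* fromℕ (X x + sumOver xs X)
    ≡⟨ cong (λ z → (a ℚ.- μ) ℚ.* (a ℚ.- μ) ℚ.+ d ℚ.+ (μ ℚ.+ μ) ℚ.* z) (fromℕ-+ (X x) (sumOver xs X)) ⟩
  (a ℚ.- μ) ℚ.* (a ℚ.- μ) ℚ.+ d ℚ.+ (μ ℚ.+ μ) ℚ.* (a ℚ.+ s)
    ≡⟨ solve 4 (λ a μ d s → (a :- μ) :* (a :- μ) :+ d :+ (μ :+ μ) :* (a :+ s) :=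
                            a :* a :+ μ :* μ :+ (d :+ (μ :+ μ) :* s)) refl a μ d s ⟩
  a ℚ.* a ℚ.+ μ ℚ.* μ ℚ.+ (d ℚ.+ (μ ℚ.+ μ) ℚ.* s)
    ≡⟨ cong (a ℚ.* a ℚ.+ μ ℚ.* μ ℚ.+_) (sumℚ-deviation xs X μ) ⟩
  a ℚ.* a ℚ.+ μ ℚ.* μ ℚ.+ (q ℚ.+ μ ℚ.* μ ℚ.* l)
    ≡⟨ solve 4 (λ a μ q l → a :* a :+ μ :* μ :+ (q :+ μ :* μ :* l) :=
                            a :* a :+ q :+ μ :* μ :* (con 1ℚ :+ l)) refl a μ q l ⟩
  a ℚ.* a ℚ.+ q ℚ.+ μ ℚ.* μ ℚ.* (1ℚ ℚ.+ l)
    ≡⟨ cong₂ (λ z w → z ℚ.+ μ ℚ.* μ ℚ.* w)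
         (trans (cong (ℚ._+ q) (sym (fromℕ-* (X x) (X x)))) (sym (fromℕ-+ (X x * X x) (sumOver xs (λ x → X x * X x)))))
         (sym (fromℕ-+ 1 (length xs))) ⟩
  fromℕ (X x * X x + sumOver xs (λ x → X x * X x)) ℚ.+ μ ℚ.* μ ℚ.* fromℕ (suc (length xs)) ∎
  where
  open ≡-Reasoning
  a = fromℕ (X x)
  d = sumℚ xs (λ x → (fromℕ (X x) ℚ.- μ) ℚ.* (fromℕ (X x) ℚ.- μ))
  s = fromℕ (sumOver xs X)
  q = fromℕ (sumOver xs (λ x → X x * X x))
  l = fromℕ (length xs)

module _ (xs : List A) (X : A → ℕ) .{{_ : ℕ.NonZero (length xs)}} where
  private
    M = length xs
    μ = 𝔼 xs (fromℕ ∘ X)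
    S = sumOver xs X
    Q = sumOver xs (λ x → X x * X x)
    V = Var xs (fromℕ ∘ X)

    μM≡S : μ ℚ.* fromℕ M ≡ fromℕ S
    μM≡S = trans (𝔼-*-length xs (fromℕ ∘ X)) (sumℚ-fromℕ xs X)

    V+μ²M≡Q : (V ℚ.+ μ ℚ.* μ) ℚ.* fromℕ M ≡ fromℕ Q
    V+μ²M≡Q = begin
      (V ℚ.+ μ ℚ.* μ) ℚ.* fromℕ M
        -- Adding and subtracting μ² m makes room for the mixed term 2 μ (μ m) of `sumℚ-deviation`.
        ≡⟨ solve 3 (λ V μ m → (V :+ μ :* μ) :* m := V :* m :+ (μ :+ μ) :* (μ :* m) :- μ :* μ :* m) refl V μ (fromℕ M) ⟩
      V ℚ.* fromℕ M ℚ.+ (μ ℚ.+ μ) ℚ.* (μ ℚ.* fromℕ M) ℚ.- μ ℚ.* μ ℚ.* fromℕ M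
        ≡⟨ cong₂ (λ v s → v ℚ.+ (μ ℚ.+ μ) ℚ.* s ℚ.- μ ℚ.* μ ℚ.* fromℕ M) (𝔼-*-length xs _) μM≡S ⟩
      _ ≡⟨ cong (ℚ._- μ ℚ.* μ ℚ.* fromℕ M) (sumℚ-deviation xs X μ) ⟩
      fromℕ Q ℚ.+ μ ℚ.* μ ℚ.* fromℕ M ℚ.- μ ℚ.* μ ℚ.* fromℕ M
        ≡⟨ solve 2 (λ q x → q :+ x :- x := q) refl (fromℕ Q) (μ ℚ.* μ ℚ.* fromℕ M) ⟩
      fromℕ Q ∎
      where open ≡-Reasoning

  𝔼≡/ : ∀ p d .{{_ : ℕ.NonZero d}} → p * M ≡ d * S → μ ≡ + p / d
  𝔼≡/ p d pM≡dS = *-fromℕ-cancelʳ M (*-fromℕ-cancelʳ d (begin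
    μ ℚ.* fromℕ M ℚ.* fromℕ d             ≡⟨ cong (ℚ._* fromℕ d) μM≡S ⟩
    fromℕ S ℚ.* fromℕ d                   ≡⟨ ℚ.*-comm (fromℕ S) (fromℕ d) ⟩
    fromℕ d ℚ.* fromℕ S                   ≡⟨ fromℕ-* d S ⟨
    fromℕ (d * S)                         ≡⟨ cong fromℕ pM≡dS ⟨
    fromℕ (p * M)                         ≡⟨ fromℕ-* p M ⟩
    fromℕ p ℚ.* fromℕ M                   ≡⟨ cong (ℚ._* fromℕ M) (/-*-fromℕ p d) ⟨
    (+ p / d) ℚ.* fromℕ d ℚ.* fromℕ M     ≡⟨ solve 3 (λ x d m → x :* d :* m := x :* m :* d) refl (+ p / d) (fromℕ d) (fromℕ M) ⟩
    (+ p / d) ℚ.* fromℕ M ℚ.* fromℕ d     ∎))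
    where open ≡-Reasoning

  -- b * e and c * (d * d) are the common denominator of r / e and (p / d)².
  Var≡/ : ∀ p d r e b c .{{_ : ℕ.NonZero d}} .{{_ : ℕ.NonZero e}} .{{_ : ℕ.NonZero (b * e)}} →
    b * e ≡ c * (d * d) → p * M ≡ d * S → (b * r + c * (p * p)) * M ≡ b * e * Q → V ≡ + r / e
  Var≡/ p d r e b c be≡cdd pM≡dS rest = ∙-cancelʳ (μ ℚ.* μ) V (+ r / e)
    (*-fromℕ-cancelʳ M (*-fromℕ-cancelʳ (b * e) (begin
      (V ℚ.+ μ ℚ.* μ) ℚ.* fromℕ M ℚ.* fromℕ (b * e)  ≡⟨ cong (ℚ._* fromℕ (b * e)) V+μ²M≡Q ⟩
      fromℕ Q ℚ.* fromℕ (b * e)                      ≡⟨ trans (ℚ.*-comm (fromℕ Q) (fromℕ (b * e))) (sym (fromℕ-* (b * e) Q)) ⟩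
      fromℕ (b * e * Q)                              ≡⟨ cong fromℕ rest ⟨
      fromℕ ((b * r + c * (p * p)) * M)              ≡⟨ trans (fromℕ-* (b * r + c * (p * p)) M) (cong (ℚ._* fromℕ M) numerator) ⟩
      (ρ ℚ.+ μ ℚ.* μ) ℚ.* fromℕ (b * e) ℚ.* fromℕ M
        ≡⟨ solve 3 (λ x k m → x :* k :* m := x :* m :* k) refl (ρ ℚ.+ μ ℚ.* μ) (fromℕ (b * e)) (fromℕ M) ⟩
      (ρ ℚ.+ μ ℚ.* μ) ℚ.* fromℕ M ℚ.* fromℕ (b * e)  ∎)))
    where
    open ≡-Reasoning
    ρ = + r / e
    p≡ : fromℕ p ≡ μ ℚ.* fromℕ d
    p≡ = trans (sym (/-*-fromℕ p d)) (cong (ℚ._* fromℕ d) (sym (𝔼≡/ p d pM≡dS)))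
    numerator : fromℕ (b * r + c * (p * p)) ≡ (ρ ℚ.+ μ ℚ.* μ) ℚ.* fromℕ (b * e)
    numerator = begin
      fromℕ (b * r + c * (p * p))   ≡⟨ fromℕ-+ (b * r) (c * (p * p)) ⟩
      fromℕ (b * r) ℚ.+ fromℕ (c * (p * p))
        ≡⟨ cong₂ ℚ._+_ (trans (fromℕ-* b r) (cong (fromℕ b ℚ.*_) (sym (/-*-fromℕ r e))))
             (trans (fromℕ-* c (p * p)) (cong (fromℕ c ℚ.*_) (trans (fromℕ-* p p) (cong₂ ℚ._*_ p≡ p≡)))) ⟩
      fromℕ b ℚ.* (ρ ℚ.* fromℕ e) ℚ.+ fromℕ c ℚ.* ((μ ℚ.* fromℕ d) ℚ.* (μ ℚ.* fromℕ d))
        ≡⟨ solve 6 (λ b ρ e c μ d → b :* (ρ :* e) :+ c :* ((μ :* d) :* (μ :* d)) :=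
             ρ :* (b :* e) :+ μ :* μ :* (c :* (d :* d))) refl (fromℕ b) ρ (fromℕ e) (fromℕ c) μ (fromℕ d) ⟩
      ρ ℚ.* (fromℕ b ℚ.* fromℕ e) ℚ.+ μ ℚ.* μ ℚ.* (fromℕ c ℚ.* (fromℕ d ℚ.* fromℕ d))
        ≡⟨ cong₂ (λ x y → ρ ℚ.* x ℚ.+ μ ℚ.* μ ℚ.* y) (fromℕ-* b e)
             (trans (fromℕ-* c (d * d)) (cong (fromℕ c ℚ.*_) (fromℕ-* d d))) ⟨
      ρ ℚ.* fromℕ (b * e) ℚ.+ μ ℚ.* μ ℚ.* fromℕ (c * (d * d))
        ≡⟨ cong (λ k → ρ ℚ.* fromℕ (b * e) ℚ.+ μ ℚ.* μ ℚ.* fromℕ k) be≡cdd ⟨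
      ρ ℚ.* fromℕ (b * e) ℚ.+ μ ℚ.* μ ℚ.* fromℕ (b * e)
        ≡⟨ ℚ.*-distribʳ-+ (fromℕ (b * e)) ρ (μ ℚ.* μ) ⟨
      (ρ ℚ.+ μ ℚ.* μ) ℚ.* fromℕ (b * e) ∎

/-square : ∀ p d x e y f b c .{{_ : ℕ.NonZero d}} .{{_ : ℕ.NonZero e}} .{{_ : ℕ.NonZero f}} .{{_ : ℕ.NonZero (b * e)}} →
  b * e ≡ c * (d * d) → b * x * f ≡ y * (c * (p * p)) →
  + x / e ≡ (+ y / f) ℚ.* ((+ p / d) ℚ.* (+ p / d))
/-square p d x e y f b c be≡cdd eq = *-fromℕ-cancelʳ (b * e) (*-fromℕ-cancelʳ f (begin
  X ℚ.* fromℕ (b * e) ℚ.* F     ≡⟨ cong (λ k → X ℚ.* k ℚ.* F) (fromℕ-* b e) ⟩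
  X ℚ.* (B ℚ.* E) ℚ.* F         ≡⟨ solve 4 (λ X B E F → X :* (B :* E) :* F := B :* (X :* E) :* F) refl X B E F ⟩
  B ℚ.* (X ℚ.* E) ℚ.* F         ≡⟨ cong (λ k → B ℚ.* k ℚ.* F) (/-*-fromℕ x e) ⟩
  B ℚ.* fromℕ x ℚ.* F           ≡⟨ trans (fromℕ-* (b * x) f) (cong (ℚ._* F) (fromℕ-* b x)) ⟨
  fromℕ (b * x * f)             ≡⟨ cong fromℕ eq ⟩
  fromℕ (y * (c * (p * p)))     ≡⟨ trans (fromℕ-* y (c * (p * p))) (cong₂ ℚ._*_ (sym (/-*-fromℕ y f)) (trans (fromℕ-* c (p * p))
                                     (cong (C ℚ.*_) (trans (fromℕ-* p p) (cong₂ ℚ._*_ (sym (/-*-fromℕ p d)) (sym (/-*-fromℕ p d))))))) ⟩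
  Y ℚ.* F ℚ.* (C ℚ.* ((P ℚ.* D) ℚ.* (P ℚ.* D)))
    ≡⟨ solve 5 (λ Y F C P D → Y :* F :* (C :* ((P :* D) :* (P :* D))) := Y :* (P :* P) :* (C :* (D :* D)) :* F) refl Y F C P D ⟩
  Y ℚ.* (P ℚ.* P) ℚ.* (C ℚ.* (D ℚ.* D)) ℚ.* F
    ≡⟨ cong (λ k → Y ℚ.* (P ℚ.* P) ℚ.* k ℚ.* F) (trans (cong (C ℚ.*_) (sym (fromℕ-* d d)))
         (trans (sym (fromℕ-* c (d * d))) (cong fromℕ (sym be≡cdd)))) ⟩
  Y ℚ.* (P ℚ.* P) ℚ.* fromℕ (b * e) ℚ.* F ∎))
  where
  open ≡-Reasoning
  X = + x / e ; Y = + y / f ; P = + p / d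
  B = fromℕ b ; C = fromℕ c ; D = fromℕ d ; E = fromℕ e ; F = fromℕ f

-- The count M and the sum S are known in closed form only as multiples; cancelling a brings an
-- identity between the closed forms back to M and S. In use, f * b ≡ a * k reads 1 * 360 = 6 * 60
-- for the mean and 5 * 8640 = 6 * 7200 for the second moment.
scale : ∀ a b q k f .{{_ : ℕ.NonZero a}} {M S A T} →
        a * M ≡ A → b * S ≡ T → q * A ≡ f * T → f * b ≡ a * k → q * M ≡ k * S
scale a b q k f {M} {S} {A} {T} aM≡A bS≡T qA≡fT fb≡ak = ℕ.*-cancelˡ-≡ (q * M) (k * S) a (begin
  a * (q * M)   ≡⟨ eq₁ a q M ⟩
  q * (a * M)   ≡⟨ cong (q *_) aM≡A ⟩
  q * A         ≡⟨ qA≡fT ⟩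
  f * T         ≡⟨ cong (f *_) bS≡T ⟨
  f * (b * S)   ≡⟨ ℕ.*-assoc f b S ⟨
  f * b * S     ≡⟨ cong (_* S) fb≡ak ⟩
  a * k * S     ≡⟨ ℕ.*-assoc a k S ⟩
  a * (k * S)   ∎)
  where
  open ≡-Reasoning
  eq₁ : ∀ a q m → a * (q * m) ≡ q * (a * m)
  eq₁ = solve-∀

-- Here n is not replaced by 2 + N, since 𝔅 (2 + N) would start to compute during type checking.
module _ {n N : ℕ} (2+N≡n : 2 + N ≡ n) where

  6*length-𝔅 : 6 * length (𝔅 n) ≡ (N + 1) * (N + 2) * (N + 3)
  6*length-𝔅 = trans (cong (6 *_) (begin
    length (𝔅 n)                ≡⟨ length≡sumOver (𝔅 n) ⟩
    sumOver (𝔅 n) (const 1)     ≡⟨ sumOver-𝔅 id (λ _ → refl) (λ _ → refl) 2+N≡n {f = const 1} {g = const 1} (λ _ → refl) ⟩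
    sumOver (codes N) (const 1) ≡⟨ length≡sumOver (codes N) ⟨
    length (codes N)            ∎)) (6*length-codes N)
    where open ≡-Reasoning

  length-𝔅-nonZero : ℕ.NonZero (length (𝔅 n))
  length-𝔅-nonZero = go (length (𝔅 n)) 6*length-𝔅
    where
    -- In this form the product reduces to a successor, so its equality with 6 * 0 is refuted by
    -- pattern matching.
    positive : ∀ N → (N + 1) * (N + 2) * (N + 3) ≡ suc N * suc (suc N) * suc (suc (suc N))
    positive = solve-∀
    go : ∀ m → 6 * m ≡ (N + 1) * (N + 2) * (N + 3) → ℕ.NonZero m
    go zero    eq with () ← trans eq (positive N)
    go (suc m) _  = _

  private
    p r : ℕ
    p = (n + 3) * (n + 2) * (n + 1)
    r = (n + 3) * (n + 2) ^ 2 * (n + 1) ^ 2 * N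

    p-eq : p * ((N + 1) * (N + 2) * (N + 3)) ≡ 1 * ((N + 1) * (N + 2) * (N + 3) * (N + 3) * (N + 4) * (N + 5))
    p-eq rewrite sym 2+N≡n = eq N
      where
      eq : ∀ N → (2 + N + 3) * (2 + N + 2) * (2 + N + 1) * ((N + 1) * (N + 2) * (N + 3)) ≡
                 1 * ((N + 1) * (N + 2) * (N + 3) * (N + 3) * (N + 4) * (N + 5))
      eq = solve-∀

    r-eq : (3 * r + 2 * (p * p)) * ((N + 1) * (N + 2) * (N + 3)) ≡
      5 * ((N + 1) * (N + 2) * (N + 2) * (N + 3) * (N + 3) * (N + 3) * (N + 4) * (N + 4) * (N + 5))
    r-eq rewrite sym 2+N≡n = eq N
      where
      eq : ∀ N → (3 * ((2 + N + 3) * ((2 + N + 2) * ((2 + N + 2) * 1)) * ((2 + N + 1) * ((2 + N + 1) * 1)) * N) +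
        2 * ((2 + N + 3) * (2 + N + 2) * (2 + N + 1) * ((2 + N + 3) * (2 + N + 2) * (2 + N + 1)))) * ((N + 1) * (N + 2) * (N + 3)) ≡
        5 * ((N + 1) * (N + 2) * (N + 2) * (N + 3) * (N + 3) * (N + 3) * (N + 4) * (N + 4) * (N + 5))
      eq = solve-∀

  module _ (X : Permutation′ n → ℕ)
    (sumX  : sumOver (𝔅 n) X ≡ sumOver (codes N) (below-size ∘ proj₂))
    (sumX² : sumOver (𝔅 n) (λ ω → X ω * X ω) ≡ sumOver (codes N) ((λ q → below-size q * below-size q) ∘ proj₂)) where

    private
      instance
        _ = length-𝔅-nonZero
      pM≡60S : p * length (𝔅 n) ≡ 60 * sumOver (𝔅 n) X
      pM≡60S = scale 6 (30 * 12) p 60 1 {length (𝔅 n)} {sumOver (𝔅 n) X} 6*length-𝔅 (trans (cong (30 * 12 *_) sumX) (360*sum-codes N)) p-eq refl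

    𝔼≡p/60 : 𝔼 (𝔅 n) (fromℕ ∘ X) ≡ + p / 60
    𝔼≡p/60 = 𝔼≡/ (𝔅 n) X p 60 pM≡60S

    Var≡r/2400 : Var (𝔅 n) (fromℕ ∘ X) ≡ + r / 2400
    -- The common denominator of r / 2400 and (p / 60)² is 3 * 2400 = 2 * 60² = 7200.
    Var≡r/2400 = Var≡/ (𝔅 n) X p 60 r 2400 3 2 refl pM≡60S
      (scale 6 (72 * 120) (3 * r + 2 * (p * p)) (3 * 2400) 5 {length (𝔅 n)} {sumOver (𝔅 n) (λ ω → X ω * X ω)} 6*length-𝔅
        (trans (cong (72 * 120 *_) sumX²) (8640*sum²-codes N)) r-eq refl)

  private
    β≡ : ∀ {ω : Permutation′ n} {t} → Represents ω t → β ω ≡ below-size (proj₂ t)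
    β≡ {t = t} R = trans (β≡length-below R) (length-below t)

    α≡ : ∀ {ω : Permutation′ n} {t} → Represents ω (dual t) → α ω ≡ below-size (proj₂ t)
    α≡ {t = t} R = trans (α≡length-below R) (length-below t)

    square : ∀ {x y} → x ≡ y → x * x ≡ y * y
    square refl = refl

    sumβ : sumOver (𝔅 n) β ≡ sumOver (codes N) (below-size ∘ proj₂)
    sumβ = sumOver-𝔅 id (λ _ → refl) (λ _ → refl) 2+N≡n β≡
    sumβ² : sumOver (𝔅 n) (λ ω → β ω * β ω) ≡ sumOver (codes N) ((λ q → below-size q * below-size q) ∘ proj₂)
    sumβ² = sumOver-𝔅 id (λ _ → refl) (λ _ → refl) 2+N≡n (λ R → square (β≡ R))
    sumα : sumOver (𝔅 n) α ≡ sumOver (codes N) (below-size ∘ proj₂)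
    sumα = sumOver-𝔅 dual (λ _ → refl) total-dual 2+N≡n α≡
    sumα² : sumOver (𝔅 n) (λ ω → α ω * α ω) ≡ sumOver (codes N) ((λ q → below-size q * below-size q) ∘ proj₂)
    sumα² = sumOver-𝔅 dual (λ _ → refl) total-dual 2+N≡n (λ R → square (α≡ R))

  𝔼β≡ : 𝔼β n ≡ + p / 60
  𝔼β≡ = 𝔼≡p/60 β sumβ sumβ²
  𝔼α≡ : 𝔼α n ≡ + p / 60
  𝔼α≡ = 𝔼≡p/60 α sumα sumα²
  Varβ≡ : Varβ n ≡ + r / 2400
  Varβ≡ = Var≡r/2400 β sumβ sumβ²
  Varα≡ : Varα n ≡ + r / 2400
  Varα≡ = Var≡r/2400 α sumα sumα²

  n-2≡N : + n ℤ.- + 2 ≡ + N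
  n-2≡N = begin
    + n ℤ.- + 2           ≡⟨ cong (λ m → + m ℤ.- + 2) (trans (sym 2+N≡n) (ℕ.+-comm 2 N)) ⟩
    + (N + 2) ℤ.- + 2     ≡⟨ ℤ.m-n≡m⊖n (N + 2) 2 ⟩
    (N + 2) ℤ.⊖ 2         ≡⟨ ℤ.⊖-≥ (ℕ.m≤n+m 2 N) ⟩
    + (N + 2 ℕ.∸ 2)       ≡⟨ cong +_ (ℕ.m+n∸n≡m N 2) ⟩
    + N                   ∎
    where open ≡-Reasoning

  *[n-2] : ∀ m → + m ℤ.* (+ n ℤ.- + 2) ≡ + (m * N)
  *[n-2] m = trans (cong (+ m ℤ.*_) n-2≡N) (sym (ℤ.pos-* m N))

  -- The relation between variance and squared mean, cross-multiplied with the same factors 3 and 2.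
  -- It holds with n and N as independent variables.
  square-eq : 3 * r * (2 * (3 + n)) ≡ 3 * N * (2 * (p * p))
  square-eq = eq n N
    where
    eq : ∀ n N → 3 * ((n + 3) * ((n + 2) * ((n + 2) * 1)) * ((n + 1) * ((n + 1) * 1)) * N) * (2 * (3 + n)) ≡
      3 * N * (2 * ((n + 3) * (n + 2) * (n + 1) * ((n + 3) * (n + 2) * (n + 1))))
    eq = solve-∀

theorem4p1 : ∀ (n : ℕ) → 2 ≤ n →
    ( 𝔼α n ≡ 𝔼β n
    × 𝔼β n ≡ + ((n + 3) * (n + 2) * (n + 1)) / 60
    × + ((n + 3) * (n + 2) * (n + 1)) / 60 ≡ + 𝔟 (n + 2) / 10 )
    ×
    ( Varα n ≡ Varβ n
    × Varβ n ≡ (+ ((n + 3) * (n + 2) ^ 2 * (n + 1) ^ 2) ℤ.* (+ n ℤ.- + 2)) / 2400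
    × (+ ((n + 3) * (n + 2) ^ 2 * (n + 1) ^ 2) ℤ.* (+ n ℤ.- + 2)) / 2400
    ≡ ((+ 3 ℤ.* (+ n ℤ.- + 2)) / (2 * (3 + n))) ℚ.* (𝔼α n ℚ.* 𝔼α n) )
theorem4p1 n 2≤n =
  let N , 2+N≡n = ℕ.m≤n⇒∃[o]m+o≡n 2≤n
      p = (n + 3) * (n + 2) * (n + 1)
      r = (n + 3) * (n + 2) ^ 2 * (n + 1) ^ 2
      r/2400 = cong (_/ 2400) (*[n-2] 2+N≡n r)
  in
  ( trans (𝔼α≡ 2+N≡n) (sym (𝔼β≡ 2+N≡n))
  , 𝔼β≡ 2+N≡n
  , /-cross p 60 (𝔟 (n + 2)) 10 (𝔟-eq n) )
  ,
  ( trans (Varα≡ 2+N≡n) (sym (Varβ≡ 2+N≡n))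
  , trans (Varβ≡ 2+N≡n) (sym r/2400)
  , trans r/2400 (trans (/-square p 60 (r * N) 2400 (3 * N) (2 * (3 + n)) 3 2 refl (square-eq 2+N≡n))
      (cong₂ (λ i μ → (i / (2 * (3 + n))) ℚ.* (μ ℚ.* μ)) (sym (*[n-2] 2+N≡n 3)) (sym (𝔼α≡ 2+N≡n)))) )
  where
  𝔟-eq : ∀ n → (n + 3) * (n + 2) * (n + 1) * 10 ≡ 𝔟 (n + 2) * 60
  𝔟-eq n = begin
    (n + 3) * (n + 2) * (n + 1) * 10     ≡⟨ eq₁ n ⟩
    -- The count is applied to n + 2 in place of n, so its N is the present n.
    (n + 1) * (n + 2) * (n + 3) * 10     ≡⟨ cong (_* 10) (6*length-𝔅 (ℕ.+-comm 2 n)) ⟨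
    6 * 𝔟 (n + 2) * 10                   ≡⟨ eq₂ (𝔟 (n + 2)) ⟩
    𝔟 (n + 2) * 60                       ∎
    where
    open ≡-Reasoning
    eq₁ : ∀ n → (n + 3) * (n + 2) * (n + 1) * 10 ≡ (n + 1) * (n + 2) * (n + 3) * 10
    eq₁ = solve-∀
    eq₂ : ∀ b → 6 * b * 10 ≡ b * 60
    eq₂ = solve-∀
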